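{- For every $m$ and every $n\ge1$, the function $$g_m(x)=\frac{1+\operatorname{sn}(x,m)}{\operatorname{cn}(x,m)}$$ satisfies $$\ddot H_n(g_m)=\Bigl(\frac{1-m}{2}\Bigr)^{\binom n2}\prod_{k=1}^{n-1}k!\,(2k)!.$$
   Context: For a power series $f(x)=\sum_{k\ge0}a_kx^k/k!$, the dilated Hankel determinant is $\ddot H_n(f)=\det(a_{2i+j})_{0\le i,j\le n-1}$. $\operatorname{sn}(x,m),\operatorname{cn}(x,m),\operatorname{dn}(x,m)$ are the Jacobi elliptic functions with parameter $m=k^2$ ($k$ the modulus): with $u=\int_0^{\phi}(1-m\sin^2\theta)^{ -1/2}d\theta$ one has $\operatorname{sn}(u,m)=\sin\phi$, $\operatorname{cn}(u,m)=\cos\phi$, $\operatorname{dn}(u,m)=(1-m\sin^2\phi)^{1/2}$. Equivalently, as power series in $x$, they satisfy $\operatorname{sn}'=\operatorname{cn}\operatorname{dn}$, $\operatorname{cn}'=-\operatorname{sn}\operatorname{dn}$, $\operatorname{dn}'=-m\operatorname{sn}\operatorname{cn}$ with values $0,1,1$ at $x=0$. The coefficients $k!\,[x^k]g_m$ are polynomials in $m$. Empty products equal $1$. -}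

module Defs where

open import Algebra.Bundles using (CommutativeRing; Semiring)
open import Data.Fin.Base using (Fin; zero; suc; toℕ; punchIn)
open import Data.Nat.Base as ℕ using (ℕ; zero; suc; _∸_; _!; _<_; s≤s)
open import Data.Nat.Properties using (m∸n≤m; n<1+n; <-≤-trans)
open import Data.Product.Base using (∃; _,_; proj₁; proj₂)
open import Data.Unit.Base using (⊤; tt)
import Algebra.Definitions.RawSemiring as RawSemiringDefs
import Algebra.Properties.Semiring.Mult as SemiringMult
import Algebra.Properties.CommutativeMonoid.Sum as CMSum
import Relation.Binary.Reasoning.Setoid as SetoidReasoning

-- Commutative rings containing ℚ: every positive integer has a (necessarily
-- unique) inverse.  Fields of characteristic zero, such as ℂ, and polynomial
-- rings such as ℚ[m] are examples.

IsℚAlgebra : ∀ {c ℓ} → CommutativeRing c ℓ → Set _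
IsℚAlgebra R = ∀ k → ∃ λ r → (suc k × 1#) * r ≈ 1#
  where
  open CommutativeRing R
  open RawSemiringDefs (Semiring.rawSemiring semiring) using (_×_)

module Matrices {c ℓ} (R : CommutativeRing c ℓ) where

  open CommutativeRing R hiding (zero)
  open RawSemiringDefs (Semiring.rawSemiring semiring) using (_^_)
  open CMSum +-commutativeMonoid using (sum-syntax)

  -- Laplace expansion along the first row.

  det : ∀ {n} → (Fin n → Fin n → Carrier) → Carrier
  det {zero}  A = 1#
  det {suc n} A =
    ∑[ j < suc n ] ((- 1#) ^ toℕ j * A zero j * det (λ i k → A (suc i) (punchIn j k)))

module FormalSeries {c ℓ} (R : CommutativeRing c ℓ) (isℚ : IsℚAlgebra R) where

  open CommutativeRing R hiding (zero)
  open RawSemiringDefs (Semiring.rawSemiring semiring) using (_×_)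
  open CMSum +-commutativeMonoid using (sum⁺-syntax; sum-cong-≋)
  open SemiringMult semiring using (×-assoc-*; ×-congʳ)
  open SetoidReasoning setoid

  1/suc : ℕ → Carrier
  1/suc k = proj₁ (isℚ k)

  ½ : Carrier
  ½ = 1/suc 1

  -- f k is the ordinary coefficient [xᵏ] f; the coefficient aₖ of
  -- f = Σ aₖ xᵏ / k! is therefore k ! × f k.

  Series : Set c
  Series = ℕ → Carrier

  infix 4 _≋_
  _≋_ : Series → Series → Set ℓ
  f ≋ g = ∀ k → f k ≈ g k

  const : Carrier → Series
  const a zero    = a
  const a (suc k) = 0#

  infixl 6 _⊕_
  infixl 7 _⊛_ _⊘_
  infix  8 ⊖_

  _⊕_ _⊛_ : Series → Series → Series
  (f ⊕ g) k = f k + g k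
  (f ⊛ g) k = ∑[ i ≤ k ] (f (toℕ i) * g (k ∸ toℕ i))

  ⊖_ : Series → Series
  (⊖ f) k = - f k

  ∂ : Series → Series
  ∂ f k = suc k × f (suc k)

  -- ∫ f is the antiderivative with constant term 0.

  ∫ : Series → Series
  ∫ f zero    = 0#
  ∫ f (suc k) = 1/suc k * f k

  egfCoeff : Series → ℕ → Carrier
  egfCoeff f k = (k !) × f k

  ∂∫ : ∀ f → ∂ (∫ f) ≋ f
  ∂∫ f k = begin
    suc k × (1/suc k * f k)          ≈⟨ ×-congʳ (suc k) (*-identityˡ _) ⟨
    suc k × (1# * (1/suc k * f k))   ≈⟨ ×-assoc-* (suc k) 1# _ ⟨
    (suc k × 1#) * (1/suc k * f k)   ≈⟨ *-assoc _ _ _ ⟨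
    ((suc k × 1#) * 1/suc k) * f k   ≈⟨ *-congʳ (proj₂ (isℚ k)) ⟩
    1# * f k                         ≈⟨ *-identityˡ _ ⟩
    f k                              ∎

  ⊛-cong-≤ : ∀ {f f′ g g′} k →
             (∀ i → i < suc k → f i ≈ f′ i) → (∀ i → i < suc k → g i ≈ g′ i) →
             (f ⊛ g) k ≈ (f′ ⊛ g′) k
  ⊛-cong-≤ k p q = sum-cong-≋ {suc k} λ i →
    *-cong (p (toℕ i) (toℕ<n i)) (q (k ∸ toℕ i) (s≤s (m∸n≤m k (toℕ i))))
    where open import Data.Fin.Properties using (toℕ<n)

  -- Families of series defined by a recursion in which the coefficient of xᵏ
  -- only uses coefficients of lower order: the coefficient of xᵏ is then the
  -- same in all iterates from the (k+1)-st on, and `fix F` collects these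
  -- stable values.

  module _ {I : Set} where

    iterate : ((I → Series) → (I → Series)) → ℕ → I → Series
    iterate F zero    i = const 0#
    iterate F (suc n) = F (iterate F n)

    fix : ((I → Series) → (I → Series)) → I → Series
    fix F i k = iterate F (suc k) i k

    Causal : ((I → Series) → (I → Series)) → Set _
    Causal F = ∀ k {s t} → (∀ i j → j < k → s i j ≈ t i j) → ∀ i → F s i k ≈ F t i k

    module _ {F} (causal : Causal F) where

      iterate-stable : ∀ n n′ i k → k < n → k < n′ → iterate F n i k ≈ iterate F n′ i k
      iterate-stable (suc n) (suc n′) i k (s≤s k≤n) (s≤s k≤n′) =
        causal k (λ i j j<k → iterate-stable n n′ i j (<-≤-trans j<k k≤n) (<-≤-trans j<k k≤n′)) i

      fix-unfold : ∀ i → fix F i ≋ F (fix F) i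
      fix-unfold i k = causal k (λ i j j<k → iterate-stable k (suc j) i j j<k (n<1+n j)) i

  -- The reciprocal of a series f with constant term 1:
  -- b₀ = 1 and bₖ₊₁ = - (f₁ bₖ + ⋯ + fₖ₊₁ b₀).

  recipStep : Series → (⊤ → Series) → ⊤ → Series
  recipStep f b tt zero    = 1#
  recipStep f b tt (suc k) = - ((λ i → f (suc i)) ⊛ b tt) k

  recip : Series → Series
  recip f = fix (recipStep f) tt

  -- f ⊘ h is only meaningful when h has constant term 1.

  _⊘_ : Series → Series → Series
  f ⊘ h = f ⊛ recip h

  recipStep-causal : ∀ f → Causal (recipStep f)
  recipStep-causal f zero    p tt = refl
  recipStep-causal f (suc k) p tt = -‿cong (⊛-cong-≤ {λ i → f (suc i)} k (λ _ _ → refl) (p tt))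

  recip-inverse : ∀ f → f 0 ≈ 1# → f ⊛ recip f ≋ const 1#
  recip-inverse f f₀≈1 zero = begin
    f 0 * 1# + 0#   ≈⟨ +-identityʳ _ ⟩
    f 0 * 1#        ≈⟨ *-identityʳ _ ⟩
    f 0             ≈⟨ f₀≈1 ⟩
    1#              ∎
  recip-inverse f f₀≈1 (suc k) = begin
    f 0 * recip f (suc k) + t   ≈⟨ +-congʳ (*-cong f₀≈1 (fix-unfold (recipStep-causal f) tt (suc k))) ⟩
    1# * (- t) + t              ≈⟨ +-congʳ (*-identityˡ _) ⟩
    - t + t                     ≈⟨ -‿inverseˡ t ⟩
    0#                          ∎
    where t = ((λ i → f (suc i)) ⊛ recip f) k

  -- The Jacobi elliptic functions with parameter m as the solution of
  -- sn′ = cn dn, cn′ = - sn dn, dn′ = - m sn cn with initial values 0, 1, 1,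
  -- written as a system of integral equations.

  data JacobiFunction : Set where
    SN CN DN : JacobiFunction

  jacobiStep : Carrier → (JacobiFunction → Series) → JacobiFunction → Series
  jacobiStep m s SN = ∫ (s CN ⊛ s DN)
  jacobiStep m s CN = const 1# ⊕ ∫ (⊖ (s SN ⊛ s DN))
  jacobiStep m s DN = const 1# ⊕ ∫ (⊖ (const m ⊛ (s SN ⊛ s CN)))

  sn cn dn : Carrier → Series
  sn m = fix (jacobiStep m) SN
  cn m = fix (jacobiStep m) CN
  dn m = fix (jacobiStep m) DN

  jacobiStep-causal : ∀ m → Causal (jacobiStep m)
  jacobiStep-causal m zero    p SN = refl
  jacobiStep-causal m zero    p CN = refl
  jacobiStep-causal m zero    p DN = refl
  jacobiStep-causal m (suc k) p SN = *-congˡ (⊛-cong-≤ k (p CN) (p DN))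
  jacobiStep-causal m (suc k) p CN =
    +-congˡ (*-congˡ (-‿cong (⊛-cong-≤ k (p SN) (p DN))))
  jacobiStep-causal m (suc k) p DN =
    +-congˡ (*-congˡ (-‿cong (⊛-cong-≤ {const m} k (λ _ _ → refl) λ i i≤k →
      ⊛-cong-≤ i (λ j j≤i → p SN j (<-≤-trans j≤i i≤k)) (λ j j≤i → p CN j (<-≤-trans j≤i i≤k)))))

  sn₀ : ∀ m → sn m 0 ≈ 0#
  sn₀ m = refl

  cn₀ : ∀ m → cn m 0 ≈ 1#
  cn₀ m = +-identityʳ 1#

  dn₀ : ∀ m → dn m 0 ≈ 1#
  dn₀ m = +-identityʳ 1#

  private
    ∂-const⊕∫ : ∀ {f} a h → f ≋ const a ⊕ ∫ h → ∂ f ≋ h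
    ∂-const⊕∫ a h p k =
      trans (×-congʳ (suc k) (trans (p (suc k)) (+-identityˡ _))) (∂∫ h k)

  sn′ : ∀ m → ∂ (sn m) ≋ cn m ⊛ dn m
  sn′ m k = trans (×-congʳ (suc k) (fix-unfold (jacobiStep-causal m) SN (suc k)))
                  (∂∫ (cn m ⊛ dn m) k)

  cn′ : ∀ m → ∂ (cn m) ≋ ⊖ (sn m ⊛ dn m)
  cn′ m = ∂-const⊕∫ 1# _ (fix-unfold (jacobiStep-causal m) CN)

  dn′ : ∀ m → ∂ (dn m) ≋ ⊖ (const m ⊛ (sn m ⊛ cn m))
  dn′ m = ∂-const⊕∫ 1# _ (fix-unfold (jacobiStep-causal m) DN)

  g : Carrier → Series
  g m = (const 1# ⊕ sn m) ⊘ cn m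

  Ḧ : ℕ → Series → Carrier
  Ḧ n f = det {n} (λ i j → egfCoeff f (2 ℕ.* toℕ i ℕ.+ toℕ j))
    where open Matrices R using (det)

-- Let s, c, d be the Jacobi functions, r = 1/c, w = d r, e = 1 - m and
-- y = s (1 + s) r² = (g² - 1)/2.  Then g′ = w g and y′ = (1 + 2y) w, while
-- w′ + w², (1 + 2y) w′ and (1 + 2y) w² are polynomials in y.  Hence ∂² maps p(y) g
-- to q(y) g with deg q ≤ deg p + 1, the coefficient of yⁿ being multiplied by
-- e (2n + 1)(n + 1), and ∂²ⁱ g = Σₖ Lᵢₖ yᵏ g with L lower triangular and
-- Lᵢᵢ = (e/2)ⁱ (2i)!.  As y = x + ⋯ and g = 1 + ⋯, the coefficients
-- Uₖⱼ = j! [xʲ] yᵏ g form an upper triangular matrix with Uₖₖ = k!, and the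
-- Hankel matrix is L U.

module Submission where

open import Defs
open import Algebra.Bundles using (CommutativeRing; Semiring)
import Algebra.Construct.Pointwise as Pointwise
import Algebra.Definitions.RawSemiring as RawSemiringDefs
open import Algebra.Morphism.Structures using (IsSemiringHomomorphism)
import Algebra.Properties.CommutativeMonoid.Mult as CMMult
import Algebra.Properties.CommutativeMonoid.Sum as CMSum
import Algebra.Properties.Ring as RingProperties
import Algebra.Properties.Semiring.Exp as SemiringExp
import Algebra.Properties.Semiring.Mult as SemiringMult
import Algebra.Properties.Semiring.Sum as SemiringSum
import Algebra.Solver.Ring.NaturalCoefficients.Default as Solver
open import Data.Fin.Base as Fin using (Fin; zero; suc; toℕ; inject₁; punchIn)
open import Data.Fin.Patterns using (0F)
open import Data.Fin.Properties using (toℕ<n)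
open import Data.Nat.Base as ℕ using (ℕ; zero; suc; _∸_; _!; _<_; _≥_; z≤n; s≤s)
open import Data.Nat.Combinatorics using (_C_; nCk+nC[k+1]≡[n+1]C[k+1]; nC1≡n)
import Data.Nat.Properties as ℕ
open import Data.Product.Base as Product using (Σ-syntax; _,_; proj₂)
open import Level using (_⊔_)
open import Relation.Binary.PropositionalEquality as ≡ using (_≡_; cong)
import Relation.Binary.Reasoning.Setoid as SetoidReasoning

-- Determinants

-- As 1 + 2y = g², the identity for (1 + 2y) w² is the quartic equation (g′)² = g² + e (g² - 1)² / 4
-- of an elliptic curve, written in y. It gives g′ only as a square root, and w carries that root:
-- an odd number of derivatives leaves a factor w behind, an even number does not. The dilation
-- matches this, because row i of the matrix consists of the coefficients of ∂²ⁱ g. The variable y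
-- is preferred to g² because it has no constant term: yᵏ g then starts at xᵏ, which makes the
-- second factor triangular. Determinants are Laplace expansions along the first row, which gives no
-- direct access to column operations or to the determinant of a product. The case of triangular
-- factors is reached through a formula for rank-one updates, whose unwanted terms cancel in pairs.
-- The algebra is left to a solver for commutative semirings, so negated terms enter it as atoms and
-- every cancellation is a step of its own.

punchIn-punchIn : ∀ {n} {i j : Fin (suc n)} → i Fin.≤ j → ∀ (l : Fin n) →
                  punchIn (inject₁ i) (punchIn j l) ≡ punchIn (suc j) (punchIn i l)
punchIn-punchIn {i = zero}              i≤j       l       = ≡.refl
punchIn-punchIn {i = suc i} {j = suc j} (s≤s i≤j) zero    = ≡.refl
punchIn-punchIn {i = suc i} {j = suc j} (s≤s i≤j) (suc l) = cong suc (punchIn-punchIn i≤j l)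

-- With `punchIn-suc`, this identifies the two columns removed on either side of `punchIn-punchIn`:
-- both orders of removal delete `inject₁ i` and `suc j` of the original numbering.
punchIn-inject₁ : ∀ {n} {i j : Fin n} → i Fin.≤ j → punchIn (inject₁ i) j ≡ suc j
punchIn-inject₁ {i = zero}              i≤j       = ≡.refl
punchIn-inject₁ {i = suc i} {j = suc j} (s≤s i≤j) = cong suc (punchIn-inject₁ i≤j)

punchIn-suc : ∀ {n} {i j : Fin n} → i Fin.≤ j → punchIn (suc j) i ≡ inject₁ i
punchIn-suc {i = zero}              i≤j       = ≡.refl
punchIn-suc {i = suc i} {j = suc j} (s≤s i≤j) = cong suc (punchIn-suc i≤j)

module Determinant {a ℓ} (R : CommutativeRing a ℓ) where

  open CommutativeRing R hiding (zero)
  open RawSemiringDefs (Semiring.rawSemiring semiring) using (_^_; product)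
  open SemiringSum semiring
  open RingProperties ring using (-1*x≈-x)
  open Matrices R using (det)
  open Solver commutativeSemiring using (solve; _:=_; _:+_; _:*_; con)
  open SetoidReasoning setoid

  Matrix : ℕ → ℕ → Set a
  Matrix m n = Fin m → Fin n → Carrier

  sign : ∀ {n} → Fin n → Carrier
  sign j = (- 1#) ^ toℕ j

  -- The solver sees `- 1#` as an atom; signs cancel below by collecting a factor `- 1# + 1#`.
  -1+1 : - 1# + 1# ≈ 0#
  -1+1 = -‿inverseˡ 1#

  sum-zero : ∀ {n} (f : Fin n → Carrier) → (∀ i → f i ≈ 0#) → sum f ≈ 0#
  sum-zero {n} f p = trans (sum-cong-≋ p) (sum-replicate-zero n)

  infixr 5 _◂_
  -- In `det-LU` only the first column is scaled or added to the others, so column operations are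
  -- stated for this shape and need no column index.
  _◂_ : ∀ {m n} → (Fin m → Carrier) → Matrix m n → Matrix m (suc n)
  (c ◂ B) i zero    = c i
  (c ◂ B) i (suc j) = B i j

  infixl 6 _⊹_
  _⊹_ : ∀ {m n} → Matrix m n → Matrix m n → Matrix m n
  (A ⊹ B) i j = A i j + B i j

  infixl 7 _⊗_
  _⊗_ : ∀ {m n} → (Fin m → Carrier) → (Fin n → Carrier) → Matrix m n
  (c ⊗ u) i j = c i * u j

  dropColumn : ∀ {m n} → Fin (suc n) → Matrix m (suc n) → Matrix m n
  dropColumn j A i k = A i (punchIn j k)

  dropRow : ∀ {m n} → Matrix (suc m) n → Matrix m n
  dropRow A i = A (suc i)

  det-cong : ∀ {n} {A B : Matrix n n} → (∀ i j → A i j ≈ B i j) → det A ≈ det B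
  det-cong {zero}  A≈B = refl
  det-cong {suc n} A≈B = sum-cong-≋ {suc n} λ j →
    *-cong (*-congˡ {sign j} (A≈B zero j)) (det-cong λ i k → A≈B (suc i) (punchIn j k))

  -- The hypothesis says that W j k depends only on the set {j, punchIn j k}; the
  -- two terms belonging to a set have opposite signs.
  alternating-sum : ∀ {n} (W : Matrix (suc n) n) →
    (∀ {i j} → i Fin.≤ j → W (inject₁ i) j ≈ W (suc j) i) →
    ∑[ j < suc n ] (sign j * ∑[ k < n ] (sign k * W j k)) ≈ 0#
  alternating-sum {zero}  W sym-W = trans (+-identityʳ _) (zeroʳ _)
  alternating-sum {suc n} W sym-W = begin
    -- A pair {0, j} occurs in the row of index 0, giving `X`, and as the leading inner term of a
    -- later row; these two cancel. The pairs avoiding 0 form the same kind of sum, one size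
    -- smaller.
    1# * X + ∑[ j < suc n ] (- 1# * sign j * (1# * W (suc j) 0F + Z j))
      ≈⟨ +-congˡ (trans (sum-cong-≋ {suc n} step) (∑-distrib-+ P₁ P₂)) ⟩
    1# * X + (∑[ j < suc n ] (- 1# * (sign j * W 0F j)) + ∑[ j < suc n ] (sign j * Z′ j))
      ≈⟨ +-congˡ (+-cong (sym (*-distribˡ-sum (- 1#) (λ j → sign j * W 0F j)))
                         (alternating-sum (λ j k → W (suc j) (suc k)) λ i≤j → sym-W (s≤s i≤j))) ⟩
    1# * X + (- 1# * X + 0#)
      ≈⟨ solve 2 (λ x e → con 1 :* x :+ (e :* x :+ con 0) := (e :+ con 1) :* x) refl X (- 1#) ⟩
    (- 1# + 1#) * X
      ≈⟨ trans (*-congʳ -1+1) (zeroˡ X) ⟩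
    0# ∎
    where
    X = ∑[ k < suc n ] (sign k * W 0F k)
    Z Z′ : Fin (suc n) → Carrier
    Z  j = ∑[ k < n ] (- 1# * sign k * W (suc j) (suc k))
    Z′ j = ∑[ k < n ] (sign k * W (suc j) (suc k))
    P₁ P₂ : Fin (suc n) → Carrier
    P₁ j = - 1# * (sign j * W 0F j)
    P₂ j = sign j * Z′ j
    Z≈ : ∀ j → Z j ≈ - 1# * Z′ j
    Z≈ j = trans (sum-cong-≋ {n} λ k → *-assoc _ _ _) (sym (*-distribˡ-sum (- 1#) (λ k → sign k * W (suc j) (suc k))))
    -1*-1 : - 1# * - 1# ≈ 1#
    -1*-1 = trans (-1*x≈-x _) (RingProperties.-‿involutive ring 1#)
    step : ∀ j → - 1# * sign j * (1# * W (suc j) 0F + Z j)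
               ≈ - 1# * (sign j * W 0F j) + sign j * Z′ j
    step j = begin
      - 1# * sign j * (1# * W (suc j) 0F + Z j)
        ≈⟨ *-congˡ (+-cong (*-congˡ (sym (sym-W z≤n))) (Z≈ j)) ⟩
      - 1# * sign j * (1# * W 0F j + - 1# * Z′ j)
        ≈⟨ solve 4 (λ e s w z → e :* s :* (con 1 :* w :+ e :* z) := e :* (s :* w) :+ e :* e :* (s :* z))
                 refl (- 1#) (sign j) (W 0F j) (Z′ j) ⟩
      - 1# * (sign j * W 0F j) + - 1# * - 1# * (sign j * Z′ j)
        ≈⟨ +-congˡ (trans (*-congʳ -1*-1) (*-identityˡ _)) ⟩
      - 1# * (sign j * W 0F j) + sign j * Z′ j ∎

  -- Minors that delete a column of `B` still begin with `c`, so inductions on the size can stay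
  -- within the shape `c ◂ B`. The factor `- 1#` accounts for column `j` of `B` being column `suc j`
  -- of `c ◂ B`.
  det-◂ : ∀ {n} (c : Fin (2 ℕ.+ n) → Carrier) (B : Matrix (2 ℕ.+ n) (1 ℕ.+ n)) →
    det (c ◂ B) ≈ c 0F * det (dropRow B)
      + - 1# * ∑[ j < suc n ] (sign j * (B 0F j * det ((λ i → c (suc i)) ◂ dropColumn j (dropRow B))))
  det-◂ {n} c B = +-cong (*-congʳ (*-identityˡ (c 0F))) (begin
    ∑[ j < suc n ] (- 1# * sign j * B 0F j * det (λ i k → (c ◂ B) (suc i) (punchIn (suc j) k)))
      ≈⟨ sum-cong-≋ {suc n} (λ j → trans (*-congˡ (det-cong (minor j)))
           (solve 4 (λ e s b d → e :* s :* b :* d := e :* (s :* (b :* d))) refl (- 1#) (sign j) (B 0F j) _)) ⟩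
    ∑[ j < suc n ] (- 1# * term j)
      ≈⟨ *-distribˡ-sum (- 1#) term ⟨
    - 1# * sum term ∎)
    where
    term : Fin (suc n) → Carrier
    term j = sign j * (B 0F j * det ((λ i → c (suc i)) ◂ dropColumn j (dropRow B)))
    minor : ∀ j i k → (c ◂ B) (suc i) (punchIn (suc j) k) ≈ ((λ i → c (suc i)) ◂ dropColumn j (dropRow B)) i k
    minor j i zero    = refl
    minor j i (suc k) = refl

  -- The matrix determinant lemma, without adjugates: by multilinearity only terms with at most one
  -- column replaced by a multiple of `c` survive, and moving that column from position `j` to the
  -- front costs `sign j`. The induction expands along the first row; terms with two columns removed
  -- cancel by `alternating-sum`.
  det-rank-one-update : ∀ {n} (B : Matrix (suc n) (suc n)) c u →
    det (B ⊹ c ⊗ u) ≈ det B + ∑[ j < suc n ] (sign j * (u j * det (c ◂ dropColumn j B)))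
  det-rank-one-update {zero} B c u =
    solve 3 (λ b c u → con 1 :* (b :+ c :* u) :* con 1 :+ con 0
                    := con 1 :* b :* con 1 :+ con 0 :+ (con 1 :* (u :* (con 1 :* c :* con 1 :+ con 0)) :+ con 0))
      refl (B 0F 0F) (c 0F) (u 0F)
  det-rank-one-update {suc n} B c u = begin
    ∑[ j < suc (suc n) ] (sign j * (b j + c₀ * u j) * det (B′ j ⊹ c′ ⊗ (λ k → u (punchIn j k))))
      ≈⟨ sum-cong-≋ {suc (suc n)} step ⟩
    ∑[ j < suc (suc n) ] (sign j * b j * det (B′ j) + sign j * (u j * det (c ◂ dropColumn j B)) + sign j * Z j)
      ≈⟨ trans (∑-distrib-+ (λ j → T₁ j + T₂ j) T₃) (+-cong (∑-distrib-+ T₁ T₂) (alternating-sum W W-symmetric)) ⟩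
    det B + ∑[ j < suc (suc n) ] (sign j * (u j * det (c ◂ dropColumn j B))) + 0#
      ≈⟨ +-identityʳ _ ⟩
    det B + ∑[ j < suc (suc n) ] (sign j * (u j * det (c ◂ dropColumn j B))) ∎
    where
    c₀ = c 0F
    b = B 0F
    c′ : Fin (suc n) → Carrier
    c′ i = c (suc i)
    B′ : Fin (suc (suc n)) → Matrix (suc n) (suc n)
    B′ j = dropColumn j (dropRow B)
    -- The total coefficient of the minor that begins with `c′` and misses columns `p` and `q`. Its
    -- symmetry in `p` and `q` is what `alternating-sum` requires.
    Q : Fin (suc (suc n)) → Fin (suc (suc n)) → Carrier
    Q p q = b p * u q + b q * u p + c₀ * (u p * u q)
    M W : Matrix (suc (suc n)) (suc n)
    M j k = det (c′ ◂ dropColumn k (B′ j))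
    W j k = Q j (punchIn j k) * M j k
    X Y Z : Fin (suc (suc n)) → Carrier
    X j = ∑[ k < suc n ] (sign k * (u (punchIn j k) * M j k))
    Y j = ∑[ k < suc n ] (sign k * (b (punchIn j k) * M j k))
    Z j = ∑[ k < suc n ] (sign k * W j k)
    T₁ T₂ T₃ : Fin (suc (suc n)) → Carrier
    T₁ j = sign j * b j * det (B′ j)
    T₂ j = sign j * (u j * det (c ◂ dropColumn j B))
    T₃ j = sign j * Z j

    M-symmetric : ∀ {i j} → i Fin.≤ j → ∀ p q →
      (c′ ◂ dropColumn j (B′ (inject₁ i))) p q ≈ (c′ ◂ dropColumn i (B′ (suc j))) p q
    M-symmetric i≤j p zero    = refl
    M-symmetric i≤j p (suc q) = reflexive (cong (B (suc p)) (punchIn-punchIn i≤j q))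

    W-symmetric : ∀ {i j} → i Fin.≤ j → W (inject₁ i) j ≈ W (suc j) i
    W-symmetric {i} {j} i≤j rewrite punchIn-inject₁ i≤j | punchIn-suc i≤j =
      *-cong (solve 5 (λ b₁ u₁ b₂ u₂ c → b₁ :* u₂ :+ b₂ :* u₁ :+ c :* (u₁ :* u₂)
                                      := b₂ :* u₁ :+ b₁ :* u₂ :+ c :* (u₂ :* u₁))
                refl (b (inject₁ i)) (u (inject₁ i)) (b (suc j)) (u (suc j)) c₀)
             (det-cong (M-symmetric i≤j))

    inner : ∀ j → (b j + c₀ * u j) * X j + u j * Y j ≈ Z j
    inner j = begin
      (b j + c₀ * u j) * X j + u j * Y j
        ≈⟨ +-cong (*-distribˡ-sum _ x) (*-distribˡ-sum _ y) ⟩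
      ∑[ k < suc n ] ((b j + c₀ * u j) * (sign k * (u (punchIn j k) * M j k)))
        + ∑[ k < suc n ] (u j * (sign k * (b (punchIn j k) * M j k)))
        ≈⟨ ∑-distrib-+ (λ k → (b j + c₀ * u j) * x k) (λ k → u j * y k) ⟨
      ∑[ k < suc n ] ((b j + c₀ * u j) * (sign k * (u (punchIn j k) * M j k))
                      + u j * (sign k * (b (punchIn j k) * M j k)))
        ≈⟨ sum-cong-≋ {suc n} (λ k → solve 7 (λ b₁ u₁ b₂ u₂ c s m →
             (b₁ :+ c :* u₁) :* (s :* (u₂ :* m)) :+ u₁ :* (s :* (b₂ :* m))
             := s :* ((b₁ :* u₂ :+ b₂ :* u₁ :+ c :* (u₁ :* u₂)) :* m))
             refl (b j) (u j) (b (punchIn j k)) (u (punchIn j k)) c₀ (sign k) (M j k)) ⟩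
      Z j ∎
      where
      x y : Fin (suc n) → Carrier
      x k = sign k * (u (punchIn j k) * M j k)
      y k = sign k * (b (punchIn j k) * M j k)

    step : ∀ j → sign j * (b j + c₀ * u j) * det (B′ j ⊹ c′ ⊗ (λ k → u (punchIn j k)))
               ≈ sign j * b j * det (B′ j) + sign j * (u j * det (c ◂ dropColumn j B)) + sign j * Z j
    step j = begin
      sign j * (b j + c₀ * u j) * det (B′ j ⊹ c′ ⊗ (λ k → u (punchIn j k)))
        ≈⟨ *-congˡ (det-rank-one-update (B′ j) c′ (λ k → u (punchIn j k))) ⟩
      sign j * (b j + c₀ * u j) * (det (B′ j) + X j)
        ≈⟨ +-identityʳ _ ⟨
      sign j * (b j + c₀ * u j) * (det (B′ j) + X j) + 0#
        ≈⟨ +-congˡ (trans (*-congʳ -1+1) (zeroˡ (sign j * (u j * Y j)))) ⟨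
      -- The inserted zero supplies `- 1# * Y j`, which `det-◂` needs to reassemble
      -- `det (c ◂ dropColumn j B)`; its counterpart `+ Y j` completes the symmetric term `Z j`.
      sign j * (b j + c₀ * u j) * (det (B′ j) + X j) + (- 1# + 1#) * (sign j * (u j * Y j))
        ≈⟨ solve 8 (λ s b c u d x y e → s :* (b :+ c :* u) :* (d :+ x) :+ (e :+ con 1) :* (s :* (u :* y))
             := s :* b :* d :+ s :* (u :* (c :* d :+ e :* y)) :+ s :* ((b :+ c :* u) :* x :+ u :* y))
             refl (sign j) (b j) c₀ (u j) (det (B′ j)) (X j) (Y j) (- 1#) ⟩
      sign j * b j * det (B′ j) + sign j * (u j * (c₀ * det (B′ j) + - 1# * Y j))
        + sign j * ((b j + c₀ * u j) * X j + u j * Y j)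
        ≈⟨ +-cong (+-congˡ (*-congˡ (*-congˡ (sym (det-◂ c (dropColumn j B)))))) (*-congˡ (inner j)) ⟩
      sign j * b j * det (B′ j) + sign j * (u j * det (c ◂ dropColumn j B)) + sign j * Z j ∎

  -- In the expansion `det-◂`, the minor without `c` changes by the rank-one formula and the
  -- first-row entries change by `c₀ * u j`. Both changes amount to `c₀ * X`, with opposite signs.
  det-column-update : ∀ {n} c (B : Matrix (suc n) n) u → det (c ◂ (B ⊹ c ⊗ u)) ≈ det (c ◂ B)
  det-column-update {zero}  c B u = +-congʳ refl
  det-column-update {suc n} c B u = begin
    det (c ◂ (B ⊹ c ⊗ u))
      ≈⟨ det-◂ c (B ⊹ c ⊗ u) ⟩
    c₀ * det (B₁ ⊹ c′ ⊗ u) + - 1# * ∑[ j < suc n ] (sign j * ((b j + c₀ * u j) * det (c′ ◂ (B′ j ⊹ c′ ⊗ (λ k → u (punchIn j k))))))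
      ≈⟨ +-cong (*-congˡ (det-rank-one-update B₁ c′ u)) (*-congˡ (trans (sum-cong-≋ {suc n} step) (∑-distrib-+ y (λ j → c₀ * x j)))) ⟩
    c₀ * (det B₁ + X) + - 1# * (∑[ j < suc n ] (sign j * (b j * det (c′ ◂ B′ j))) + ∑[ j < suc n ] (c₀ * (sign j * (u j * det (c′ ◂ B′ j)))))
      ≈⟨ +-congˡ (*-congˡ (+-congˡ (*-distribˡ-sum c₀ x))) ⟨
    c₀ * (det B₁ + X) + - 1# * (Y + c₀ * X)
      ≈⟨ solve 5 (λ c d x y e → c :* (d :+ x) :+ e :* (y :+ c :* x) := (e :+ con 1) :* (c :* x) :+ (c :* d :+ e :* y))
           refl c₀ (det B₁) X Y (- 1#) ⟩
    (- 1# + 1#) * (c₀ * X) + (c₀ * det B₁ + - 1# * Y)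
      ≈⟨ trans (+-congʳ (trans (*-congʳ -1+1) (zeroˡ _))) (+-identityˡ _) ⟩
    c₀ * det B₁ + - 1# * Y
      ≈⟨ det-◂ c B ⟨
    det (c ◂ B) ∎
    where
    c₀ = c 0F
    b = B 0F
    c′ : Fin (suc n) → Carrier
    c′ i = c (suc i)
    B₁ : Matrix (suc n) (suc n)
    B₁ = dropRow B
    B′ : Fin (suc n) → Matrix (suc n) n
    B′ j = dropColumn j B₁
    x y : Fin (suc n) → Carrier
    x j = sign j * (u j * det (c′ ◂ B′ j))
    y j = sign j * (b j * det (c′ ◂ B′ j))
    X Y : Carrier
    X = sum x
    Y = sum y
    step : ∀ j → sign j * ((b j + c₀ * u j) * det (c′ ◂ (B′ j ⊹ c′ ⊗ (λ k → u (punchIn j k)))))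
               ≈ sign j * (b j * det (c′ ◂ B′ j)) + c₀ * (sign j * (u j * det (c′ ◂ B′ j)))
    step j = trans (*-congˡ (*-congˡ (det-column-update c′ (B′ j) (λ k → u (punchIn j k)))))
      (solve 5 (λ s b c u d → s :* ((b :+ c :* u) :* d) := s :* (b :* d) :+ c :* (s :* (u :* d)))
         refl (sign j) (b j) c₀ (u j) _)

  det-column-scale : ∀ {n} x c (B : Matrix (suc n) n) → det ((λ i → x * c i) ◂ B) ≈ x * det (c ◂ B)
  det-column-scale {zero}  x c B =
    solve 2 (λ x c → con 1 :* (x :* c) :* con 1 :+ con 0 := x :* (con 1 :* c :* con 1 :+ con 0)) refl x (c 0F)
  det-column-scale {suc n} x c B = begin
    det ((λ i → x * c i) ◂ B)
      ≈⟨ det-◂ (λ i → x * c i) B ⟩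
    x * c 0F * d + - 1# * ∑[ j < suc n ] (sign j * (B 0F j * det ((λ i → x * c (suc i)) ◂ B′ j)))
      ≈⟨ +-congˡ (*-congˡ (trans (sum-cong-≋ {suc n} step) (sym (*-distribˡ-sum x y)))) ⟩
    x * c 0F * d + - 1# * (x * X)
      ≈⟨ solve 5 (λ x c d e y → x :* c :* d :+ e :* (x :* y) := x :* (c :* d :+ e :* y)) refl x (c 0F) d (- 1#) X ⟩
    x * (c 0F * d + - 1# * X)
      ≈⟨ *-congˡ (det-◂ c B) ⟨
    x * det (c ◂ B) ∎
    where
    d = det (dropRow B)
    B′ : Fin (suc n) → Matrix (suc n) n
    B′ j = dropColumn j (dropRow B)
    y : Fin (suc n) → Carrier
    y j = sign j * (B 0F j * det ((λ i → c (suc i)) ◂ B′ j))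
    X = sum y
    step : ∀ j → sign j * (B 0F j * det ((λ i → x * c (suc i)) ◂ B′ j))
               ≈ x * (sign j * (B 0F j * det ((λ i → c (suc i)) ◂ B′ j)))
    step j = trans (*-congˡ (*-congˡ (det-column-scale x (λ i → c (suc i)) (B′ j))))
      (solve 4 (λ s b x d → s :* (b :* (x :* d)) := x :* (s :* (b :* d))) refl (sign j) (B 0F j) x _)

  det-sparse-row : ∀ {n} c (B : Matrix (suc n) n) → (∀ j → B 0F j ≈ 0#) → det (c ◂ B) ≈ c 0F * det (dropRow B)
  det-sparse-row {n} c B B₀≈0 = trans (+-cong (*-congʳ (*-identityˡ (c 0F)))
    (sum-zero {n} _ λ j → trans (*-congʳ (trans (*-congˡ (B₀≈0 j)) (zeroʳ _))) (zeroˡ _))) (+-identityʳ _)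

  -- The first column of L U is U₀₀ L₀; subtracting U₀ⱼ L₀ from the j-th column
  -- for j > 0 clears the rest of the first row.
  det-LU : ∀ {n} (L U : Matrix n n) →
    (∀ {i k} → i Fin.< k → L i k ≈ 0#) → (∀ {k j} → j Fin.< k → U k j ≈ 0#) →
    det (λ i j → ∑[ k < n ] (L i k * U k j)) ≈ product {n} (λ i → L i i * U i i)
  det-LU {zero}  L U L-lower U-upper = refl
  det-LU {suc n} L U L-lower U-upper = begin
    det (λ i j → ∑[ k < suc n ] (L i k * U k j))
      ≈⟨ det-cong columns ⟩
    det ((λ i → U 0F 0F * L i 0F) ◂ (B ⊹ (λ i → L i 0F) ⊗ (λ j → U 0F (suc j))))
      ≈⟨ det-column-scale (U 0F 0F) (λ i → L i 0F) _ ⟩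
    U 0F 0F * det ((λ i → L i 0F) ◂ (B ⊹ (λ i → L i 0F) ⊗ (λ j → U 0F (suc j))))
      ≈⟨ *-congˡ (det-column-update (λ i → L i 0F) B _) ⟩
    U 0F 0F * det ((λ i → L i 0F) ◂ B)
      ≈⟨ *-congˡ (det-sparse-row (λ i → L i 0F) B λ j →
           sum-zero {n} _ λ k → trans (*-congʳ (L-lower (s≤s z≤n))) (zeroˡ _)) ⟩
    U 0F 0F * (L 0F 0F * det (dropRow B))
      -- `dropRow B` is the product of `L` and `U` with their first rows and columns deleted, and
      -- these blocks are again triangular.
      ≈⟨ trans (sym (*-assoc _ _ _)) (*-cong (*-comm _ _)
           (det-LU (λ i k → L (suc i) (suc k)) (λ k j → U (suc k) (suc j))
              (λ i<k → L-lower (s≤s i<k)) (λ j<k → U-upper (s≤s j<k)))) ⟩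
    product {suc n} (λ i → L i i * U i i) ∎
    where
    B : Matrix (suc n) n
    B i j = ∑[ k < n ] (L i (suc k) * U (suc k) (suc j))
    columns : ∀ i j → ∑[ k < suc n ] (L i k * U k j)
      ≈ ((λ i → U 0F 0F * L i 0F) ◂ (B ⊹ (λ i → L i 0F) ⊗ (λ j → U 0F (suc j)))) i j
    columns i zero    = trans (+-cong (*-comm _ _)
      (sum-zero {n} _ λ k → trans (*-congˡ (U-upper (s≤s z≤n))) (zeroʳ _))) (+-identityʳ _)
    columns i (suc j) = +-comm _ _

-- Derivations and formal power series

-- The identities for the Jacobi functions and for polynomials in y are proved over an arbitrary
-- ring with a derivation, so that no Cauchy product appears in them.
record IsDerivation {a ℓ} (S : CommutativeRing a ℓ)
                    (δ : CommutativeRing.Carrier S → CommutativeRing.Carrier S) : Set (a ⊔ ℓ) where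
  open CommutativeRing S
  field
    δ-cong : ∀ {x y} → x ≈ y → δ x ≈ δ y
    δ-+    : ∀ x y → δ (x + y) ≈ δ x + δ y
    δ-*    : ∀ x y → δ (x * y) ≈ δ x * y + x * δ y

module SeriesRing {a ℓ} (R : CommutativeRing a ℓ) (isℚ : IsℚAlgebra R) where

  open CommutativeRing R hiding (zero)
  open SemiringSum semiring
  open SemiringMult semiring
  open CMMult +-commutativeMonoid using (×-distrib-+)
  open FormalSeries R isℚ
  open Solver commutativeSemiring using (solve; _:=_; _:+_; _:*_; con)
  open SetoidReasoning setoid

  tail : Series → Series
  tail f k = f (suc k)

  ⊛-cong : ∀ {f f′ g g′} → f ≋ f′ → g ≋ g′ → f ⊛ g ≋ f′ ⊛ g′
  ⊛-cong {f} {f′} {g} {g′} p q k = ⊛-cong-≤ {f} {f′} {g} {g′} k (λ i _ → p i) (λ i _ → q i)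

  -- By definition a Cauchy product splits off the constant term of its first factor. This is the
  -- mirror image, and having both makes commutativity an induction on the index.
  ⊛-sucʳ : ∀ f g k → (f ⊛ g) (suc k) ≈ f (suc k) * g 0 + (f ⊛ tail g) k
  ⊛-sucʳ f g zero = solve 2 (λ x y → x :+ (y :+ con 0) := y :+ (x :+ con 0)) refl (f 0 * g 1) (f 1 * g 0)
  ⊛-sucʳ f g (suc k) = begin
    f 0 * g (2 ℕ.+ k) + (tail f ⊛ g) (suc k)
      ≈⟨ +-congˡ (⊛-sucʳ (tail f) g k) ⟩
    f 0 * g (2 ℕ.+ k) + (f (2 ℕ.+ k) * g 0 + (tail f ⊛ tail g) k)
      ≈⟨ solve 3 (λ x y z → x :+ (y :+ z) := y :+ (x :+ z)) refl _ _ _ ⟩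
    f (2 ℕ.+ k) * g 0 + (f 0 * g (2 ℕ.+ k) + (tail f ⊛ tail g) k) ∎

  ⊛-comm : ∀ f g → f ⊛ g ≋ g ⊛ f
  ⊛-comm f g zero    = +-congʳ (*-comm _ _)
  ⊛-comm f g (suc k) = trans (+-cong (*-comm _ _) (⊛-comm (tail f) g k)) (sym (⊛-sucʳ g f k))

  ⊛-distribʳ : ∀ h f g → (f ⊕ g) ⊛ h ≋ (f ⊛ h) ⊕ (g ⊛ h)
  ⊛-distribʳ h f g k = trans (sum-cong-≋ {suc k} λ i → distribʳ (h (k ∸ toℕ i)) (f (toℕ i)) (g (toℕ i)))
    (∑-distrib-+ {suc k} (λ i → f (toℕ i) * h (k ∸ toℕ i)) (λ i → g (toℕ i) * h (k ∸ toℕ i)))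

  ⊛-distribˡ : ∀ h f g → h ⊛ (f ⊕ g) ≋ (h ⊛ f) ⊕ (h ⊛ g)
  ⊛-distribˡ h f g k = trans (⊛-comm h (f ⊕ g) k)
    (trans (⊛-distribʳ h f g k) (+-cong (⊛-comm f h k) (⊛-comm g h k)))

  scale-⊛ : ∀ x f g k → ((λ i → x * f i) ⊛ g) k ≈ x * (f ⊛ g) k
  scale-⊛ x f g k = trans (sum-cong-≋ {suc k} λ i → *-assoc x (f (toℕ i)) (g (k ∸ toℕ i)))
    (sym (*-distribˡ-sum {suc k} x (λ i → f (toℕ i) * g (k ∸ toℕ i))))

  -- `tail (f ⊛ g)` unfolds to `f 0` times `tail g` plus `tail f ⊛ g`, so the coefficient at `suc k`
  -- reduces to associativity for `tail f` at `k`.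
  ⊛-assoc : ∀ f g h → (f ⊛ g) ⊛ h ≋ f ⊛ (g ⊛ h)
  ⊛-assoc f g h zero =
    solve 3 (λ x y z → (x :* y :+ con 0) :* z :+ con 0 := x :* (y :* z :+ con 0) :+ con 0) refl (f 0) (g 0) (h 0)
  ⊛-assoc f g h (suc k) = begin
    (f 0 * g 0 + 0#) * h (suc k) + (((λ i → f 0 * g (suc i)) ⊕ (tail f ⊛ g)) ⊛ h) k
      ≈⟨ +-congˡ (⊛-distribʳ h (λ i → f 0 * g (suc i)) (tail f ⊛ g) k) ⟩
    (f 0 * g 0 + 0#) * h (suc k) + (((λ i → f 0 * g (suc i)) ⊛ h) k + ((tail f ⊛ g) ⊛ h) k)
      ≈⟨ +-congˡ (+-cong (scale-⊛ (f 0) (tail g) h k) (⊛-assoc (tail f) g h k)) ⟩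
    (f 0 * g 0 + 0#) * h (suc k) + (f 0 * (tail g ⊛ h) k + (tail f ⊛ (g ⊛ h)) k)
      ≈⟨ solve 5 (λ x y z u v → (x :* y :+ con 0) :* z :+ (x :* u :+ v) := x :* (y :* z :+ u) :+ v)
           refl (f 0) (g 0) (h (suc k)) _ _ ⟩
    f 0 * (g 0 * h (suc k) + (tail g ⊛ h) k) + (tail f ⊛ (g ⊛ h)) k ∎

  0⊛ : ∀ {f} g → (∀ i → f i ≈ 0#) → ∀ k → (f ⊛ g) k ≈ 0#
  0⊛ g f≈0 k = trans (sum-cong-≋ {suc k} λ i → trans (*-congʳ (f≈0 (toℕ i))) (zeroˡ (g (k ∸ toℕ i))))
                     (sum-replicate-zero (suc k))

  const-⊛ : ∀ x f k → (const x ⊛ f) k ≈ x * f k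
  const-⊛ x f zero    = +-identityʳ _
  const-⊛ x f (suc k) = trans (+-congˡ (0⊛ f (λ i → refl) k)) (+-identityʳ _)

  ⊛-identityˡ : ∀ f → const 1# ⊛ f ≋ f
  ⊛-identityˡ f k = trans (const-⊛ 1# f k) (*-identityˡ _)

  seriesRing : CommutativeRing a ℓ
  seriesRing = record
    { Carrier = Series
    ; _≈_ = _≋_
    ; _+_ = _⊕_
    ; _*_ = _⊛_
    ; -_ = ⊖_
    ; 0# = λ _ → 0#
    ; 1# = const 1#
    ; isCommutativeRing = record
      { isRing = record
        { +-isAbelianGroup = Pointwise.isAbelianGroup ℕ +-isAbelianGroup
        ; *-cong = λ {f} {f′} {g} {g′} → ⊛-cong {f} {f′} {g} {g′}
        ; *-assoc = ⊛-assoc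
        ; *-identity = ⊛-identityˡ , λ f k → trans (⊛-comm f (const 1#) k) (⊛-identityˡ f k)
        ; distrib = ⊛-distribˡ , ⊛-distribʳ
        }
      ; *-comm = ⊛-comm
      }
    }

  const-isHomomorphism : IsSemiringHomomorphism (Semiring.rawSemiring semiring) (Semiring.rawSemiring (CommutativeRing.semiring seriesRing)) const
  const-isHomomorphism = record
    { isNearSemiringHomomorphism = record
      { +-isMonoidHomomorphism = record
        { isMagmaHomomorphism = record
          { isRelHomomorphism = record { cong = λ { x≈y zero → x≈y ; x≈y (suc k) → refl } }
          ; homo = λ { x y zero → refl ; x y (suc k) → sym (+-identityʳ 0#) }
          }
        ; ε-homo = λ { zero → refl ; (suc k) → refl }
        }
      ; *-homo = λ { x y zero → sym (const-⊛ x (const y) 0)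
                   ; x y (suc k) → sym (trans (const-⊛ x (const y) (suc k)) (zeroʳ x)) }
      }
    ; 1#-homo = λ k → refl
    }

  ∂-cong : ∀ {f g} → f ≋ g → ∂ f ≋ ∂ g
  ∂-cong p k = ×-congʳ (suc k) (p (suc k))

  ∂-⊕ : ∀ f g → ∂ (f ⊕ g) ≋ ∂ f ⊕ ∂ g
  ∂-⊕ f g k = ×-distrib-+ (f (suc k)) (g (suc k)) (suc k)

  ∂-const : ∀ x k → ∂ (const x) k ≈ 0#
  ∂-const x k = trans (sym (sum-replicate (suc k))) (sum-replicate-zero (suc k))

  ×-distrib-sum : ∀ n {k} (f : Fin k → Carrier) → n × sum f ≈ ∑[ i < k ] (n × f i)
  ×-distrib-sum n {zero}  f = trans (sym (sum-replicate n)) (sum-replicate-zero n)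
  ×-distrib-sum n {suc k} f = trans (×-distrib-+ _ _ n) (+-congˡ (×-distrib-sum n λ i → f (suc i)))

  -- The Euler operator x d/dx respects the grading of the Cauchy product, so
  -- its Leibniz rule holds term by term.
  euler : Series → Series
  euler f k = k × f k

  euler-⊛ : ∀ f g → euler (f ⊛ g) ≋ (euler f ⊛ g) ⊕ (f ⊛ euler g)
  euler-⊛ f g k = begin
    k × (f ⊛ g) k
      ≈⟨ ×-distrib-sum k {suc k} (λ i → f (toℕ i) * g (k ∸ toℕ i)) ⟩
    ∑[ i ≤ k ] (k × (f (toℕ i) * g (k ∸ toℕ i)))
      ≈⟨ sum-cong-≋ {suc k} term ⟩
    ∑[ i ≤ k ] (euler f (toℕ i) * g (k ∸ toℕ i) + f (toℕ i) * euler g (k ∸ toℕ i))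
      ≈⟨ ∑-distrib-+ {suc k} (λ i → euler f (toℕ i) * g (k ∸ toℕ i)) (λ i → f (toℕ i) * euler g (k ∸ toℕ i)) ⟩
    ((euler f ⊛ g) ⊕ (f ⊛ euler g)) k ∎
    where
    term : ∀ (i : Fin (suc k)) → k × (f (toℕ i) * g (k ∸ toℕ i))
         ≈ euler f (toℕ i) * g (k ∸ toℕ i) + f (toℕ i) * euler g (k ∸ toℕ i)
    term i = begin
      k × p
        ≡⟨ cong (_× p) (ℕ.m+[n∸m]≡n (ℕ.≤-pred (toℕ<n i))) ⟨
      (toℕ i ℕ.+ (k ∸ toℕ i)) × p
        ≈⟨ ×-homo-+ p (toℕ i) (k ∸ toℕ i) ⟩
      toℕ i × p + (k ∸ toℕ i) × p
        ≈⟨ +-cong (×-assoc-* (toℕ i) _ _) (×-comm-* (k ∸ toℕ i) _ _) ⟨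
      euler f (toℕ i) * g (k ∸ toℕ i) + f (toℕ i) * euler g (k ∸ toℕ i) ∎
      where p = f (toℕ i) * g (k ∸ toℕ i)

  -- `∂ f` is `euler f` shifted by one place, so this is `euler-⊛` at `suc k`. The boundary terms
  -- vanish because `euler` kills the constant term.
  ∂-⊛ : ∀ f g → ∂ (f ⊛ g) ≋ (∂ f ⊛ g) ⊕ (f ⊛ ∂ g)
  ∂-⊛ f g k = begin
    euler (f ⊛ g) (suc k)
      ≈⟨ euler-⊛ f g (suc k) ⟩
    (0# * g (suc k) + (∂ f ⊛ g) k) + (f ⊛ euler g) (suc k)
      ≈⟨ +-congˡ (⊛-sucʳ f (euler g) k) ⟩
    (0# * g (suc k) + (∂ f ⊛ g) k) + (f (suc k) * 0# + (f ⊛ ∂ g) k)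
      ≈⟨ solve 4 (λ x y z w → (con 0 :* x :+ y) :+ (z :* con 0 :+ w) := y :+ w) refl (g (suc k)) _ (f (suc k)) _ ⟩
    (∂ f ⊛ g) k + (f ⊛ ∂ g) k ∎

  ∂-isDerivation : IsDerivation seriesRing ∂
  ∂-isDerivation = record { δ-cong = ∂-cong ; δ-+ = ∂-⊕ ; δ-* = ∂-⊛ }

  -- Division by `suc k` is where inverses of positive integers enter. This turns the two first
  -- integrals of the Jacobi system into identities fixed by their values at x = 0.
  ∂≋0⇒const : ∀ f → (∀ k → ∂ f k ≈ 0#) → f ≋ const (f 0)
  ∂≋0⇒const f p zero    = refl
  ∂≋0⇒const f p (suc k) = begin
    f (suc k)                               ≈⟨ *-identityˡ _ ⟨
    1# * f (suc k)                          ≈⟨ *-congʳ (proj₂ (isℚ k)) ⟨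
    (suc k × 1#) * 1/suc k * f (suc k)      ≈⟨ solve 3 (λ x y z → x :* y :* z := y :* (x :* z)) refl _ _ _ ⟩
    1/suc k * ((suc k × 1#) * f (suc k))    ≈⟨ *-congˡ (trans (×-assoc-* (suc k) _ _) (×-congʳ (suc k) (*-identityˡ _))) ⟩
    1/suc k * ∂ f k                         ≈⟨ trans (*-congˡ (p k)) (zeroʳ _) ⟩
    0#                                      ∎

  -- Orders of vanishing and exponential coefficients

  ⊛-order : ∀ h {f} k → (∀ {i} → i < k → f i ≈ 0#) → ∀ {j} → j < k → (h ⊛ f) j ≈ 0#
  ⊛-order h {f} k p {j} j<k = trans
    (⊛-cong-≤ {h} {h} {f} {λ _ → 0#} j (λ _ _ → refl) λ i i≤j → p (ℕ.<-≤-trans i≤j j<k))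
    (trans (⊛-comm h (λ _ → 0#) j) (0⊛ h (λ _ → refl) j))

  ⊛-leading : ∀ h {f} k → (∀ {i} → i < k → f i ≈ 0#) → (h ⊛ f) k ≈ h 0 * f k
  ⊛-leading h     zero    p = +-identityʳ _
  ⊛-leading h {f} (suc k) p = trans (+-congˡ (⊛-order (tail h) (suc k) p ℕ.≤-refl)) (+-identityʳ _)

  egfCoeff-∂ : ∀ f k → egfCoeff (∂ f) k ≈ egfCoeff f (suc k)
  egfCoeff-∂ f k = trans (×-assocˡ _ (k !) (suc k)) (×-congˡ (ℕ.*-comm (k !) (suc k)))

-- Differential identities for the Jacobi functions

module _ {a ℓ} (S : CommutativeRing a ℓ) where

  open CommutativeRing S

  module JacobiDerivation
    (δ : Carrier → Carrier) (δ-isDerivation : IsDerivation S δ)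
    (m s c d : Carrier) (δm : δ m ≈ 0#)
    (δs : δ s ≈ c * d) (δc : δ c ≈ - (s * d)) (δd : δ d ≈ - (m * (s * c))) where

    open IsDerivation δ-isDerivation
    open RingProperties ring using (+-cancelʳ)
    open Solver commutativeSemiring using (solve; _:=_; _:+_; _:*_; con)
    open SetoidReasoning setoid

    δ-² : ∀ x → δ (x * x) ≈ x * δ x + x * δ x
    δ-² x = trans (δ-* x x) (+-congʳ (*-comm _ _))

    δ[s²+c²] : δ (s * s + c * c) ≈ 0#
    δ[s²+c²] = begin
      δ (s * s + c * c)
        ≈⟨ trans (δ-+ _ _) (+-cong (δ-² s) (δ-² c)) ⟩
      (s * δ s + s * δ s) + (c * δ c + c * δ c)
        ≈⟨ +-cong (+-cong (*-congˡ δs) (*-congˡ δs)) (+-cong (*-congˡ δc) (*-congˡ δc)) ⟩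
      (s * (c * d) + s * (c * d)) + (c * - (s * d) + c * - (s * d))
        ≈⟨ solve 4 (λ s c d n → (s :* (c :* d) :+ s :* (c :* d)) :+ (c :* n :+ c :* n) := (n :+ s :* d) :* (c :+ c))
             refl s c d (- (s * d)) ⟩
      (- (s * d) + s * d) * (c + c)
        ≈⟨ trans (*-congʳ (-‿inverseˡ _)) (zeroˡ _) ⟩
      0# ∎

    δ[d²+ms²] : δ (d * d + m * (s * s)) ≈ 0#
    δ[d²+ms²] = begin
      δ (d * d + m * (s * s))
        ≈⟨ trans (δ-+ _ _) (+-cong (δ-² d) (trans (δ-* m (s * s)) (+-cong (*-congʳ δm) (*-congˡ (δ-² s))))) ⟩
      (d * δ d + d * δ d) + (0# * (s * s) + m * (s * δ s + s * δ s))
        ≈⟨ +-cong (+-cong (*-congˡ δd) (*-congˡ δd)) (+-congˡ (*-congˡ (+-cong (*-congˡ δs) (*-congˡ δs)))) ⟩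
      (d * - (m * (s * c)) + d * - (m * (s * c))) + (0# * (s * s) + m * (s * (c * d) + s * (c * d)))
        ≈⟨ solve 5 (λ m s c d n → (d :* n :+ d :* n) :+ (con 0 :* (s :* s) :+ m :* (s :* (c :* d) :+ s :* (c :* d)))
                               := (n :+ m :* (s :* c)) :* (d :+ d))
             refl m s c d (- (m * (s * c))) ⟩
      (- (m * (s * c)) + m * (s * c)) * (d + d)
        ≈⟨ trans (*-congʳ (-‿inverseˡ _)) (zeroˡ _) ⟩
      0# ∎

    -- A derivation alone only shows both quadratic forms to be constants, so their value 1 is a
    -- hypothesis. Giving `e` by `m + e ≈ 1#` instead of a difference keeps the identities within
    -- reach of the semiring solver.
    module WithReciprocal (e r : Carrier) (m+e≈1 : m + e ≈ 1#) (cr≈1 : c * r ≈ 1#)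
             (s²+c²≈1 : s * s + c * c ≈ 1#) (d²+ms²≈1 : d * d + m * (s * s) ≈ 1#) where

      -- Since s² + c² = 1, `z` is 1/(1 - s) and `y` is s/(1 - s), while `w` is the logarithmic
      -- derivative of `g`.
      g z y w : Carrier
      g = (1# + s) * r
      z = (1# + s) * (r * r)
      y = s * z
      w = d * r

      -- Multiplying by c² r² = 1 makes s² + c² = 1 applicable.
      insert : ∀ x → x ≈ (c * r) * ((c * r) * x)
      insert x = sym (trans (trans (*-congʳ cr≈1) (*-identityˡ _)) (trans (*-congʳ cr≈1) (*-identityˡ _)))

      z≈1+y : z ≈ 1# + y
      z≈1+y = begin
        (1# + s) * (r * r)
          ≈⟨ solve 2 (λ s r → (con 1 :+ s) :* (r :* r) := con 1 :* (r :* r) :+ s :* (r :* r)) refl s r ⟩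
        1# * (r * r) + s * (r * r)
          ≈⟨ +-congʳ (*-congʳ s²+c²≈1) ⟨
        (s * s + c * c) * (r * r) + s * (r * r)
          ≈⟨ solve 3 (λ s c r → (s :* s :+ c :* c) :* (r :* r) :+ s :* (r :* r)
                             := (c :* r) :* ((c :* r) :* con 1) :+ s :* ((con 1 :+ s) :* (r :* r))) refl s c r ⟩
        (c * r) * ((c * r) * 1#) + y
          ≈⟨ +-congʳ (insert 1#) ⟨
        1# + y ∎

      d²≈e+mc² : d * d ≈ e + m * (c * c)
      d²≈e+mc² = +-cancelʳ (m * (s * s)) _ _ (begin
        d * d + m * (s * s)                  ≈⟨ trans d²+ms²≈1 (sym m+e≈1) ⟩
        m + e                                ≈⟨ +-congʳ (*-identityʳ m) ⟨
        m * 1# + e                           ≈⟨ +-congʳ (*-congˡ s²+c²≈1) ⟨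
        m * (s * s + c * c) + e
          ≈⟨ solve 4 (λ m e s c → m :* (s :+ c) :+ e := e :+ m :* c :+ m :* s) refl m e (s * s) (c * c) ⟩
        e + m * (c * c) + m * (s * s)        ∎)

      δ1 : δ 1# ≈ 0#
      δ1 = +-cancelʳ (δ 1#) _ _ (begin
        δ 1# + δ 1#               ≈⟨ +-cong (*-identityˡ _) (*-identityˡ _) ⟨
        1# * δ 1# + 1# * δ 1#     ≈⟨ δ-² 1# ⟨
        δ (1# * 1#)               ≈⟨ δ-cong (*-identityˡ 1#) ⟩
        δ 1#                      ≈⟨ +-identityˡ _ ⟨
        0# + δ 1#                 ∎)

      δ-1+ : ∀ x → δ (1# + x) ≈ δ x
      δ-1+ x = trans (δ-+ 1# x) (trans (+-congʳ δ1) (+-identityˡ _))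

      -- Differentiating `c * r ≈ 1#` determines `c * δ r`; multiplying by `r` removes the factor
      -- `c`.
      δr : δ r ≈ s * d * (r * r)
      δr = begin
        δ r                       ≈⟨ trans (*-congʳ cr≈1) (*-identityˡ _) ⟨
        (c * r) * δ r             ≈⟨ solve 3 (λ c r x → (c :* r) :* x := r :* (c :* x)) refl c r (δ r) ⟩
        r * (c * δ r)             ≈⟨ *-congˡ (+-cancelʳ (- (s * d) * r) _ _ (begin
          c * δ r + - (s * d) * r         ≈⟨ +-comm _ _ ⟩
          - (s * d) * r + c * δ r         ≈⟨ +-congʳ (*-congʳ δc) ⟨
          δ c * r + c * δ r               ≈⟨ δ-* c r ⟨
          δ (c * r)                       ≈⟨ trans (δ-cong cr≈1) δ1 ⟩
          0#                              ≈⟨ trans (*-congʳ (-‿inverseʳ _)) (zeroˡ r) ⟨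
          (s * d + - (s * d)) * r         ≈⟨ distribʳ _ _ _ ⟩
          s * d * r + - (s * d) * r       ∎)) ⟩
        r * (s * d * r)           ≈⟨ solve 3 (λ s d r → r :* (s :* d :* r) := s :* d :* (r :* r)) refl s d r ⟩
        s * d * (r * r)           ∎

      δg : δ g ≈ w * g
      δg = begin
        δ ((1# + s) * r)
          ≈⟨ trans (δ-* _ _) (+-cong (*-congʳ (trans (δ-1+ s) δs)) (*-congˡ δr)) ⟩
        c * d * r + (1# + s) * (s * d * (r * r))
          ≈⟨ +-congʳ (insert _) ⟩
        (c * r) * ((c * r) * (c * d * r)) + (1# + s) * (s * d * (r * r))
          ≈⟨ solve 4 (λ s c d r →
               (c :* r) :* ((c :* r) :* (c :* d :* r)) :+ (con 1 :+ s) :* (s :* d :* (r :* r))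
               := (c :* r) :* (c :* c) :* (d :* r :* r) :+ (s :+ s :* s) :* (d :* r :* r)) refl s c d r ⟩
        (c * r) * (c * c) * (d * r * r) + (s + s * s) * (d * r * r)
          ≈⟨ +-congʳ (*-congʳ (trans (*-congʳ cr≈1) (*-identityˡ _))) ⟩
        c * c * (d * r * r) + (s + s * s) * (d * r * r)
          ≈⟨ solve 4 (λ s c d r → c :* c :* (d :* r :* r) :+ (s :+ s :* s) :* (d :* r :* r)
               := ((s :* s :+ c :* c) :+ s) :* (d :* r :* r)) refl s c d r ⟩
        ((s * s + c * c) + s) * (d * r * r)
          ≈⟨ *-congʳ (+-congʳ s²+c²≈1) ⟩
        (1# + s) * (d * r * r)
          ≈⟨ solve 3 (λ s d r → (con 1 :+ s) :* (d :* r :* r) := d :* r :* ((con 1 :+ s) :* r)) refl s d r ⟩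
        w * g ∎

      δy : δ y ≈ (1# + y + y) * w
      δy = begin
        -- As `z` and `y` differ by 1, differentiating `z` saves one use of the product rule.
        δ y                     ≈⟨ trans (δ-cong z≈1+y) (δ-1+ y) ⟨
        δ ((1# + s) * (r * r))
          ≈⟨ trans (δ-* _ _) (+-cong (*-congʳ (trans (δ-1+ s) δs))
               (*-congˡ (trans (δ-² r) (+-cong (*-congˡ δr) (*-congˡ δr))))) ⟩
        c * d * (r * r) + (1# + s) * (r * (s * d * (r * r)) + r * (s * d * (r * r)))
          ≈⟨ solve 4 (λ s c d r →
               c :* d :* (r :* r) :+ (con 1 :+ s) :* (r :* (s :* d :* (r :* r)) :+ r :* (s :* d :* (r :* r)))
               := (c :* r :+ s :* ((con 1 :+ s) :* (r :* r)) :+ s :* ((con 1 :+ s) :* (r :* r))) :* (d :* r))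
               refl s c d r ⟩
        (c * r + y + y) * w     ≈⟨ *-congʳ (+-congʳ (+-congʳ cr≈1)) ⟩
        (1# + y + y) * w        ∎

      w²≈m+er² : w * w ≈ m + e * (r * r)
      w²≈m+er² = begin
        d * r * (d * r)
          ≈⟨ solve 2 (λ d r → d :* r :* (d :* r) := d :* d :* (r :* r)) refl d r ⟩
        d * d * (r * r)
          ≈⟨ *-congʳ d²≈e+mc² ⟩
        (e + m * (c * c)) * (r * r)
          ≈⟨ solve 4 (λ m e c r → (e :+ m :* (c :* c)) :* (r :* r) := (c :* r) :* ((c :* r) :* m) :+ e :* (r :* r))
               refl m e c r ⟩
        (c * r) * ((c * r) * m) + e * (r * r)
          ≈⟨ +-congʳ (insert m) ⟨
        m + e * (r * r) ∎

      δw : δ w ≈ e * (s * (r * r))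
      δw = begin
        δ (d * r)
          ≈⟨ trans (δ-* _ _) (+-cong (*-congʳ δd) (*-congˡ δr)) ⟩
        - n * r + d * (s * d * (r * r))
          ≈⟨ solve 4 (λ s d r n → n :* r :+ d :* (s :* d :* (r :* r)) := n :* r :+ d :* d :* (s :* (r :* r)))
               refl s d r (- n) ⟩
        - n * r + d * d * (s * (r * r))
          ≈⟨ +-congˡ (*-congʳ d²≈e+mc²) ⟩
        - n * r + (e + m * (c * c)) * (s * (r * r))
          ≈⟨ solve 6 (λ m e s c r n → n :* r :+ (e :+ m :* (c :* c)) :* (s :* (r :* r))
               := n :* r :+ (c :* r) :* (m :* (s :* c) :* r) :+ e :* (s :* (r :* r))) refl m e s c r (- n) ⟩
        - n * r + (c * r) * (n * r) + e * (s * (r * r))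
          ≈⟨ +-congʳ (+-congˡ (trans (*-congʳ cr≈1) (*-identityˡ _))) ⟩
        - n * r + n * r + e * (s * (r * r))
          ≈⟨ +-congʳ (trans (sym (distribʳ _ _ _)) (trans (*-congʳ (-‿inverseˡ n)) (zeroˡ r))) ⟩
        0# + e * (s * (r * r))
          ≈⟨ +-identityˡ _ ⟩
        e * (s * (r * r)) ∎
        where n = m * (s * c)

      δw+w² : δ w + w * w ≈ 1# + e * y
      δw+w² = begin
        δ w + w * w                            ≈⟨ +-cong δw w²≈m+er² ⟩
        e * (s * (r * r)) + (m + e * (r * r))
          ≈⟨ solve 4 (λ m e s r → e :* (s :* (r :* r)) :+ (m :+ e :* (r :* r)) := m :+ e :* ((con 1 :+ s) :* (r :* r)))
               refl m e s r ⟩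
        m + e * z                              ≈⟨ +-congˡ (*-congˡ z≈1+y) ⟩
        m + e * (1# + y)                       ≈⟨ solve 3 (λ m e y → m :+ e :* (con 1 :+ y) := m :+ e :+ e :* y) refl m e y ⟩
        m + e + e * y                          ≈⟨ +-congʳ m+e≈1 ⟩
        1# + e * y                             ∎

      -- As 1 + 2y = (1 + s)² r², multiplying by it turns the r² in w² and in `δ w` into the square
      -- of `z`, a polynomial in y.
      [1+2y]r²≈z² : (1# + y + y) * (r * r) ≈ z * z
      [1+2y]r²≈z² = begin
        (1# + y + y) * (r * r)
          ≈⟨ *-congʳ (+-congʳ (+-congʳ (insert 1#))) ⟩
        ((c * r) * ((c * r) * 1#) + y + y) * (r * r)
          ≈⟨ solve 3 (λ s c r →
               ((c :* r) :* ((c :* r) :* con 1) :+ s :* ((con 1 :+ s) :* (r :* r)) :+ s :* ((con 1 :+ s) :* (r :* r))) :* (r :* r)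
               := ((s :* s :+ c :* c) :+ (s :+ s :+ s :* s)) :* (r :* r :* (r :* r))) refl s c r ⟩
        ((s * s + c * c) + (s + s + s * s)) * (r * r * (r * r))
          ≈⟨ *-congʳ (+-congʳ s²+c²≈1) ⟩
        (1# + (s + s + s * s)) * (r * r * (r * r))
          ≈⟨ solve 2 (λ s r → (con 1 :+ (s :+ s :+ s :* s)) :* (r :* r :* (r :* r))
               := ((con 1 :+ s) :* (r :* r)) :* ((con 1 :+ s) :* (r :* r))) refl s r ⟩
        z * z ∎

      [1+2y]δw : (1# + y + y) * δ w ≈ e * (y + y * y)
      [1+2y]δw = begin
        (1# + y + y) * δ w                      ≈⟨ *-congˡ δw ⟩
        (1# + y + y) * (e * (s * (r * r)))
          ≈⟨ solve 4 (λ x e s r → x :* (e :* (s :* (r :* r))) := e :* (s :* (x :* (r :* r)))) refl (1# + y + y) e s r ⟩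
        e * (s * ((1# + y + y) * (r * r)))      ≈⟨ *-congˡ (*-congˡ [1+2y]r²≈z²) ⟩
        e * (s * (z * z))                       ≈⟨ *-congˡ (*-assoc _ _ _) ⟨
        e * (y * z)                             ≈⟨ *-congˡ (*-congˡ z≈1+y) ⟩
        e * (y * (1# + y))                      ≈⟨ solve 2 (λ e y → e :* (y :* (con 1 :+ y)) := e :* (y :+ y :* y)) refl e y ⟩
        e * (y + y * y)                         ∎

      [1+2y]w² : (1# + y + y) * (w * w) ≈ 1# + y + y + e * (y * y)
      [1+2y]w² = begin
        (1# + y + y) * (w * w)                       ≈⟨ *-congˡ w²≈m+er² ⟩
        (1# + y + y) * (m + e * (r * r))
          ≈⟨ solve 4 (λ x m e r → x :* (m :+ e :* (r :* r)) := m :* x :+ e :* (x :* (r :* r))) refl (1# + y + y) m e r ⟩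
        m * (1# + y + y) + e * ((1# + y + y) * (r * r))
          ≈⟨ +-congˡ (*-congˡ (trans [1+2y]r²≈z² (*-cong z≈1+y z≈1+y))) ⟩
        m * (1# + y + y) + e * ((1# + y) * (1# + y))
          ≈⟨ solve 3 (λ m e y → m :* (con 1 :+ y :+ y) :+ e :* ((con 1 :+ y) :* (con 1 :+ y))
                             := (m :+ e) :* (con 1 :+ y :+ y) :+ e :* (y :* y)) refl m e y ⟩
        (m + e) * (1# + y + y) + e * (y * y)         ≈⟨ +-congʳ (trans (*-congʳ m+e≈1) (*-identityˡ _)) ⟩
        1# + y + y + e * (y * y)                     ∎

-- Polynomials in y times g

module _ {a ℓ b ℓ′} (K : CommutativeRing a ℓ) (S : CommutativeRing b ℓ′) where

  private module K = CommutativeRing K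
  open CommutativeRing S hiding (zero)

  module Polynomials (ι : K.Carrier → Carrier)
    (ι-isHomomorphism : IsSemiringHomomorphism (Semiring.rawSemiring K.semiring) (Semiring.rawSemiring semiring) ι)
    (y g : Carrier) where

    open IsSemiringHomomorphism ι-isHomomorphism renaming (⟦⟧-cong to ι-cong)
    open RawSemiringDefs (Semiring.rawSemiring semiring) using (_^_)
    open SemiringSum semiring
    open Solver commutativeSemiring using (solve; _:=_; _:+_; _:*_; con)
    open SetoidReasoning setoid

    -- Poly n x f: f = p(y) g for a polynomial p over K, in Horner form, of
    -- degree at most n and with x as coefficient of yⁿ.

    data Poly : ℕ → K.Carrier → Carrier → Set (a ⊔ b ⊔ ℓ′) where
      base : ∀ {x f} → f ≈ ι x * g → Poly 0 x f
      step : ∀ {n x f h} u → Poly n x h → f ≈ ι u * g + y * h → Poly (suc n) x f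

    resp : ∀ {n x f f′} → f ≈ f′ → Poly n x f → Poly n x f′
    resp f≈f′ (base p)     = base (trans (sym f≈f′) p)
    resp f≈f′ (step u P p) = step u P (trans (sym f≈f′) p)

    top-cong : ∀ {n x x′ f} → x K.≈ x′ → Poly n x f → Poly n x′ f
    top-cong x≈x′ (base p)     = base (trans p (*-congʳ (ι-cong x≈x′)))
    top-cong x≈x′ (step u P p) = step u (top-cong x≈x′ P) p

    infixl 6 _⊞_
    _⊞_ : ∀ {n x x′ f f′} → Poly n x f → Poly n x′ f′ → Poly n (x K.+ x′) (f + f′)
    base {x} {f} p ⊞ base {x′} {f′} p′ = base (begin
      f + f′                  ≈⟨ +-cong p p′ ⟩
      ι x * g + ι x′ * g      ≈⟨ distribʳ g (ι x) (ι x′) ⟨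
      (ι x + ι x′) * g        ≈⟨ *-congʳ (+-homo x x′) ⟨
      ι (x K.+ x′) * g        ∎)
    step {f = f} {h} u P p ⊞ step {f = f′} {h′} u′ P′ p′ = step (u K.+ u′) (P ⊞ P′) (begin
      f + f′                                      ≈⟨ +-cong p p′ ⟩
      (ι u * g + y * h) + (ι u′ * g + y * h′)
        ≈⟨ solve 6 (λ u u′ g y h h′ → (u :* g :+ y :* h) :+ (u′ :* g :+ y :* h′) := (u :+ u′) :* g :+ y :* (h :+ h′))
             refl (ι u) (ι u′) g y h h′ ⟩
      (ι u + ι u′) * g + y * (h + h′)             ≈⟨ +-congʳ (*-congʳ (+-homo u u′)) ⟨
      ι (u K.+ u′) * g + y * (h + h′)             ∎)

    scale : ∀ {n x f} v → Poly n x f → Poly n (v K.* x) (ι v * f)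
    scale {x = x} {f} v (base p) = base (begin
      ι v * f               ≈⟨ *-congˡ p ⟩
      ι v * (ι x * g)       ≈⟨ *-assoc _ _ _ ⟨
      ι v * ι x * g         ≈⟨ *-congʳ (*-homo v x) ⟨
      ι (v K.* x) * g       ∎)
    scale {f = f} v (step {h = h} u P p) = step (v K.* u) (scale v P) (begin
      ι v * f                           ≈⟨ *-congˡ p ⟩
      ι v * (ι u * g + y * h)
        ≈⟨ solve 5 (λ v u g y h → v :* (u :* g :+ y :* h) := v :* u :* g :+ y :* (v :* h)) refl (ι v) (ι u) g y h ⟩
      ι v * ι u * g + y * (ι v * h)     ≈⟨ +-congʳ (*-congʳ (*-homo v u)) ⟨
      ι (v K.* u) * g + y * (ι v * h)   ∎)

    ι0* : ∀ x → ι K.0# * x ≈ 0#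
    ι0* x = trans (*-congʳ 0#-homo) (zeroˡ x)

    y* : ∀ {n x f} → Poly n x f → Poly (suc n) x (y * f)
    y* P = step K.0# P (sym (trans (+-congʳ (ι0* g)) (+-identityˡ _)))

    0-poly : ∀ n → Poly n K.0# 0#
    0-poly zero    = base (sym (ι0* g))
    0-poly (suc n) = resp (zeroʳ y) (y* (0-poly n))

    ι*g : ∀ u n → Poly (suc n) K.0# (ι u * g)
    ι*g u n = step u (0-poly n) (sym (trans (+-congˡ (zeroʳ y)) (+-identityʳ _)))

    weaken : ∀ {n x f} → Poly n x f → Poly (suc n) K.0# f
    weaken {x = x} (base p) = resp (sym p) (ι*g x 0)
    weaken (step u P p)     = step u (weaken P) p

    -- Coefficients belong to the witness and not to `f`: no uniqueness is claimed, and any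
    -- expansion yields a factorisation.
    coeff : ∀ {n x f} → Poly n x f → ℕ → K.Carrier
    coeff {x = x} (base p)     zero    = x
    coeff         (base p)     (suc k) = K.0#
    coeff         (step u P p) zero    = u
    coeff         (step u P p) (suc k) = coeff P k

    coeff-top : ∀ {n x f} (P : Poly n x f) → coeff P n ≡ x
    coeff-top (base p)     = ≡.refl
    coeff-top (step u P p) = coeff-top P

    coeff-beyond : ∀ {n x f} (P : Poly n x f) {k} → n < k → coeff P k ≡ K.0#
    coeff-beyond (base p)     {suc k} n<k       = ≡.refl
    coeff-beyond (step u P p) {suc k} (s≤s n<k) = coeff-beyond P n<k

    expansion : ∀ {n x f} (P : Poly n x f) {N} → n < N →
                f ≈ ∑[ k < N ] (ι (coeff P (toℕ k)) * (y ^ toℕ k * g))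
    expansion {x = x} {f} (base p) {suc N} n<N = begin
      f
        ≈⟨ p ⟩
      ι x * g
        ≈⟨ trans (+-congʳ (*-congˡ (*-identityˡ g))) (+-identityʳ _) ⟨
      ι x * (1# * g) + 0#
        ≈⟨ +-congˡ (trans (sum-cong-≋ {N} (λ k → ι0* (y ^ toℕ (suc k) * g))) (sum-replicate-zero N)) ⟨
      ι x * (1# * g) + ∑[ k < N ] (ι K.0# * (y ^ toℕ (suc k) * g)) ∎
    expansion {f = f} (step {h = h} u P p) {suc N} (s≤s n<N) = begin
      f
        ≈⟨ p ⟩
      ι u * g + y * h
        ≈⟨ +-cong (*-congˡ (sym (*-identityˡ g))) (*-congˡ (expansion P n<N)) ⟩
      ι u * (1# * g) + y * ∑[ k < N ] (ι (coeff P (toℕ k)) * (y ^ toℕ k * g))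
        ≈⟨ +-congˡ (trans (*-distribˡ-sum {N} y (λ k → ι (coeff P (toℕ k)) * (y ^ toℕ k * g)))
             (sum-cong-≋ {N} λ k → solve 4 (λ y c p g → y :* (c :* (p :* g)) := c :* (y :* p :* g)) refl
                y (ι (coeff P (toℕ k))) (y ^ toℕ k) g)) ⟩
      ι u * (1# * g) + ∑[ k < N ] (ι (coeff P (toℕ k)) * (y ^ suc (toℕ k) * g)) ∎

    module _ (δ : Carrier → Carrier) (δ-isDerivation : IsDerivation S δ) (δ-ι : ∀ x → δ (ι x) ≈ 0#)
      (e : K.Carrier) (w : Carrier)
      (δg : δ g ≈ w * g) (δy : δ y ≈ (1# + y + y) * w)
      (δw+w² : δ w + w * w ≈ 1# + ι e * y)
      ([1+2y]δw : (1# + y + y) * δ w ≈ ι e * (y + y * y))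
      ([1+2y]w² : (1# + y + y) * (w * w) ≈ 1# + y + y + ι e * (y * y)) where

      open IsDerivation δ-isDerivation
      open RawSemiringDefs (Semiring.rawSemiring K.semiring) using () renaming (_×_ to _·_)

      δ-ι* : ∀ u x → δ (ι u * x) ≈ ι u * δ x
      δ-ι* u x = trans (δ-* (ι u) x) (trans (+-congʳ (trans (*-congʳ (δ-ι u)) (zeroˡ x))) (+-identityˡ _))

      δδg : δ (δ g) ≈ g + y * (ι e * g)
      δδg = begin
        δ (δ g)                   ≈⟨ trans (δ-cong δg) (trans (δ-* w g) (+-congˡ (*-congˡ δg))) ⟩
        δ w * g + w * (w * g)     ≈⟨ solve 3 (λ v w g → v :* g :+ w :* (w :* g) := (v :+ w :* w) :* g) refl (δ w) w g ⟩
        (δ w + w * w) * g         ≈⟨ *-congʳ δw+w² ⟩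
        (1# + ι e * y) * g        ≈⟨ solve 3 (λ e y g → (con 1 :+ e :* y) :* g := g :+ y :* (e :* g)) refl (ι e) y g ⟩
        g + y * (ι e * g)         ∎

      -- The polynomial form of (1 + 2y) w², that is of (g′)². A product of two first derivatives
      -- contains w², which is absorbed here.
      Φ : Carrier
      Φ = 1# + y + y + ι e * (y * y)

      δδy : δ (δ y) ≈ Φ + Φ + ι e * (y + y * y)
      δδy = begin
        δ (δ y)
          ≈⟨ trans (δ-cong δy) (δ-* (1# + y + y) w) ⟩
        δ (1# + y + y) * w + (1# + y + y) * δ w
          ≈⟨ +-cong (*-congʳ (trans (δ-+ (1# + y) y) (+-congʳ (trans (δ-+ 1# y) (trans (+-congʳ δ1) (+-identityˡ _)))))) [1+2y]δw ⟩
        (δ y + δ y) * w + ι e * (y + y * y)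
          ≈⟨ +-congʳ (*-congʳ (+-cong δy δy)) ⟩
        ((1# + y + y) * w + (1# + y + y) * w) * w + ι e * (y + y * y)
          ≈⟨ +-congʳ (solve 2 (λ x w → (x :* w :+ x :* w) :* w := x :* (w :* w) :+ x :* (w :* w)) refl (1# + y + y) w) ⟩
        (1# + y + y) * (w * w) + (1# + y + y) * (w * w) + ι e * (y + y * y)
          ≈⟨ +-congʳ (+-cong [1+2y]w² [1+2y]w²) ⟩
        Φ + Φ + ι e * (y + y * y) ∎
        where
        δ1 : δ 1# ≈ 0#
        δ1 = trans (δ-cong (sym 1#-homo)) (δ-ι K.1#)

      δδ-* : ∀ x h → δ (δ (x * h)) ≈ δ (δ x) * h + (δ x * δ h + δ x * δ h) + x * δ (δ h)
      δδ-* x h = begin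
        δ (δ (x * h))
          ≈⟨ trans (δ-cong (δ-* x h)) (trans (δ-+ _ _) (+-cong (δ-* _ _) (δ-* _ _))) ⟩
        (δ (δ x) * h + δ x * δ h) + (δ x * δ h + x * δ (δ h))
          ≈⟨ solve 3 (λ p q r → (p :+ q) :+ (q :+ r) := p :+ (q :+ q) :+ r) refl _ _ _ ⟩
        δ (δ x) * h + (δ x * δ h + δ x * δ h) + x * δ (δ h) ∎

      Φ-poly : ∀ {n x f} → Poly n x f → Poly (suc (suc n)) (e K.* x) (Φ * f)
      Φ-poly {n} {x} {f} P = top-cong (K.trans (K.+-congʳ (K.+-identityˡ K.0#)) (K.+-identityˡ _))
        (resp (solve 3 (λ e y f → f :+ y :* (f :+ f) :+ y :* (y :* (e :* f)) := (con 1 :+ y :+ y :+ e :* (y :* y)) :* f)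
                 refl (ι e) y f)
          -- Only the summand e y² of `Φ` reaches the top degree; the others are padded there with
          -- coefficient 0.
          (weaken (weaken P) ⊞ y* (top-cong (K.+-identityˡ K.0#) (weaken P ⊞ weaken P)) ⊞ y* (y* (scale e P))))

      -- δ preserves the polynomials in y times g only up to the factor w, which
      -- is why the quotient H of δ f by w is carried along.

      top₁ top₂ : ℕ → K.Carrier → K.Carrier
      top₁ n x = (K.1# K.+ (n · K.1# K.+ n · K.1#)) K.* x
      top₂ n x = e K.* ((K.1# K.+ (n · K.1# K.+ n · K.1#)) K.* (K.1# K.+ n · K.1#)) K.* x

      -- The derivative of yⁿ g is w times (2n + 1) yⁿ g + n yⁿ⁻¹ g, whence `top₁`. To leading order
      -- in y both `δ w` and w² are e y / 2, so a second derivative multiplies the top coefficient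
      -- by (e/2) (1 + (2n + 1)), whence `top₂`. The induction follows the Horner form.
      derivatives : ∀ {n x f} → Poly n x f →
        (Σ[ H ∈ Carrier ] (Poly n (top₁ n x) H Product.× δ f ≈ w * H)) Product.× Poly (suc n) (top₂ n x) (δ (δ f))
      derivatives {x = x} {f} (base p) = (ι x * g , base (*-congʳ (ι-cong (K.sym top₁≈))) , δf) ,
        step x (base (*-congʳ (ι-cong (K.sym top₂≈)))) δδf
        where
        module KS = Solver K.commutativeSemiring
        top₁≈ : top₁ 0 x K.≈ x
        top₁≈ = KS.solve 1 (λ x → (KS.con 1 KS.:+ (KS.con 0 KS.:+ KS.con 0)) KS.:* x KS.:= x) K.refl x
        top₂≈ : top₂ 0 x K.≈ e K.* x
        top₂≈ = KS.solve 2 (λ e x → e KS.:* ((KS.con 1 KS.:+ (KS.con 0 KS.:+ KS.con 0)) KS.:* (KS.con 1 KS.:+ KS.con 0)) KS.:* x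
                                 KS.:= e KS.:* x) K.refl e x
        δf : δ f ≈ w * (ι x * g)
        δf = begin
          δ f             ≈⟨ trans (δ-cong p) (trans (δ-ι* x g) (*-congˡ δg)) ⟩
          ι x * (w * g)   ≈⟨ solve 3 (λ x w g → x :* (w :* g) := w :* (x :* g)) refl (ι x) w g ⟩
          w * (ι x * g)   ∎
        δδf : δ (δ f) ≈ ι x * g + y * (ι (e K.* x) * g)
        δδf = begin
          δ (δ f)
            ≈⟨ trans (δ-cong (trans (δ-cong p) (δ-ι* x g))) (trans (δ-ι* x (δ g)) (*-congˡ δδg)) ⟩
          ι x * (g + y * (ι e * g))
            ≈⟨ solve 4 (λ x e y g → x :* (g :+ y :* (e :* g)) := x :* g :+ y :* (e :* x :* g)) refl (ι x) (ι e) y g ⟩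
          ι x * g + y * (ι e * ι x * g)
            ≈⟨ +-congˡ (*-congˡ (*-congʳ (*-homo e x))) ⟨
          ι x * g + y * (ι (e K.* x) * g) ∎
      derivatives {suc n} {x} {f} (step {h = h} u P p) with derivatives P
      ... | (H , P₁ , δh) , P₂ =
        -- The quotient of `δ f` by `w`: `δ y * h` contributes (1 + 2y) h and `y * δ h` contributes
        -- y H.
        (ι u * g + y * (h + h + H) + h
        , top-cong top₁≈ (step u (P ⊞ P ⊞ P₁) refl ⊞ weaken P)
        , δf)
        , top-cong top₂≈ (resp (sym δδf)
            -- The two `Φ` terms combine 2 Φ h from `δ (δ y) * h` with 2 Φ H from the mixed term 2
            -- `δ y * δ h`.
            (step u (ι*g (e K.* u) n ⊞ scale e (weaken P ⊞ y* P) ⊞ P₂) refl ⊞ (Φ-poly (P ⊞ P₁) ⊞ Φ-poly (P ⊞ P₁))))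
        where
        ν = n · K.1#
        module KS = Solver K.commutativeSemiring
        top₁≈ : x K.+ x K.+ top₁ n x K.+ K.0# K.≈ top₁ (suc n) x
        top₁≈ = KS.solve 2 (λ ν x → x KS.:+ x KS.:+ (KS.con 1 KS.:+ (ν KS.:+ ν)) KS.:* x KS.:+ KS.con 0
          KS.:= (KS.con 1 KS.:+ ((KS.con 1 KS.:+ ν) KS.:+ (KS.con 1 KS.:+ ν))) KS.:* x) K.refl ν x
        top₂≈ : (K.0# K.+ e K.* (K.0# K.+ x) K.+ top₂ n x) K.+ (e K.* (x K.+ top₁ n x) K.+ e K.* (x K.+ top₁ n x))
                K.≈ top₂ (suc n) x
        top₂≈ = KS.solve 3 (λ e ν x →
          let 1+2ν = KS.con 1 KS.:+ (ν KS.:+ ν) ; ν′ = KS.con 1 KS.:+ ν ; q = e KS.:* (x KS.:+ 1+2ν KS.:* x)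
          in (KS.con 0 KS.:+ e KS.:* (KS.con 0 KS.:+ x) KS.:+ e KS.:* (1+2ν KS.:* ν′) KS.:* x) KS.:+ (q KS.:+ q)
             KS.:= e KS.:* ((KS.con 1 KS.:+ (ν′ KS.:+ ν′)) KS.:* (KS.con 1 KS.:+ ν′)) KS.:* x)
          K.refl e ν x
        δf : δ f ≈ w * (ι u * g + y * (h + h + H) + h)
        δf = begin
          δ f
            ≈⟨ trans (δ-cong p) (trans (δ-+ _ _) (+-cong (δ-ι* u g) (δ-* y h))) ⟩
          ι u * δ g + (δ y * h + y * δ h)
            ≈⟨ +-cong (*-congˡ δg) (+-cong (*-congʳ δy) (*-congˡ δh)) ⟩
          ι u * (w * g) + ((1# + y + y) * w * h + y * (w * H))
            ≈⟨ solve 6 (λ u g y h H w → u :* (w :* g) :+ ((con 1 :+ y :+ y) :* w :* h :+ y :* (w :* H))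
                 := w :* (u :* g :+ y :* (h :+ h :+ H) :+ h)) refl (ι u) g y h H w ⟩
          w * (ι u * g + y * (h + h + H) + h) ∎
        δyδh : δ y * δ h ≈ Φ * H
        δyδh = begin
          δ y * δ h                       ≈⟨ *-cong δy δh ⟩
          (1# + y + y) * w * (w * H)
            ≈⟨ solve 3 (λ x w H → x :* w :* (w :* H) := x :* (w :* w) :* H) refl (1# + y + y) w H ⟩
          (1# + y + y) * (w * w) * H      ≈⟨ *-congʳ [1+2y]w² ⟩
          Φ * H                           ∎
        δδf : δ (δ f) ≈ ι u * g + y * (ι (e K.* u) * g + ι e * (h + y * h) + δ (δ h)) + (Φ * (h + H) + Φ * (h + H))
        δδf = begin
          δ (δ f)
            ≈⟨ trans (δ-cong (trans (δ-cong p) (δ-+ _ _))) (δ-+ _ _) ⟩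
          δ (δ (ι u * g)) + δ (δ (y * h))
            ≈⟨ +-cong (trans (δ-cong (δ-ι* u g)) (δ-ι* u (δ g))) (δδ-* y h) ⟩
          ι u * δ (δ g) + (δ (δ y) * h + (δ y * δ h + δ y * δ h) + y * δ (δ h))
            ≈⟨ +-cong (*-congˡ δδg) (+-congʳ (+-cong (*-congʳ δδy) (+-cong δyδh δyδh))) ⟩
          ι u * (g + y * (ι e * g)) + ((Φ + Φ + ι e * (y + y * y)) * h + (Φ * H + Φ * H) + y * δ (δ h))
            ≈⟨ solve 8 (λ u g y e h H F k →
                 u :* (g :+ y :* (e :* g)) :+ ((F :+ F :+ e :* (y :+ y :* y)) :* h :+ (F :* H :+ F :* H) :+ y :* k)
                 := u :* g :+ y :* (e :* u :* g :+ e :* (h :+ y :* h) :+ k) :+ (F :* (h :+ H) :+ F :* (h :+ H)))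
                 refl (ι u) g y (ι e) h H Φ (δ (δ h)) ⟩
          ι u * g + y * (ι e * ι u * g + ι e * (h + y * h) + δ (δ h)) + (Φ * (h + H) + Φ * (h + H))
            ≈⟨ +-congʳ (+-congˡ (*-congˡ (+-congʳ (+-congʳ (*-congʳ (*-homo e u)))))) ⟨
          ι u * g + y * (ι (e K.* u) * g + ι e * (h + y * h) + δ (δ h)) + (Φ * (h + H) + Φ * (h + H)) ∎

-- The dilated Hankel determinant of g

module HankelEvaluation {a ℓ} (R : CommutativeRing a ℓ) (isℚ : IsℚAlgebra R) (m : CommutativeRing.Carrier R) where

  open CommutativeRing R hiding (zero)
  open FormalSeries R isℚ using (Series; _≋_; const; _⊕_; _⊛_; ∂; sn; cn; dn; sn′; cn′; dn′; cn₀; dn₀;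
    recip; recip-inverse; egfCoeff; ½; Ḧ) renaming (g to gₘ)
  open SeriesRing R isℚ
  open SemiringSum semiring
  open SemiringMult semiring
  open SemiringExp semiring
  open RawSemiringDefs (Semiring.rawSemiring semiring) using (product)
  open CMSum *-commutativeMonoid using ()
    renaming (∑-distrib-+ to product-*; sum-cong-≋ to product-cong; sum-replicate to product-replicate)
  open Solver commutativeSemiring using (solve; _:=_; _:+_; _:*_; con)
  open SetoidReasoning setoid
  open Determinant R using (det-cong; det-LU)
  module S = CommutativeRing seriesRing
  module SSum = SemiringSum S.semiring
  open RawSemiringDefs (Semiring.rawSemiring S.semiring) using () renaming (_^_ to _^ˢ_)

  open JacobiDerivation seriesRing ∂ ∂-isDerivation (const m) (sn m) (cn m) (dn m)
    (∂-const m) (sn′ m) (cn′ m) (dn′ m)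

  e t : Carrier
  e = 1# - m
  t = e * ½

  m+e≋1 : const m ⊕ const e ≋ const 1#
  m+e≋1 zero    = trans (+-comm m e) (trans (+-assoc 1# (- m) m) (trans (+-congˡ (-‿inverseˡ m)) (+-identityʳ 1#)))
  m+e≋1 (suc k) = +-identityʳ 0#

  s²+c²≋1 : (sn m ⊛ sn m) ⊕ (cn m ⊛ cn m) ≋ const 1#
  s²+c²≋1 = S.trans (∂≋0⇒const _ δ[s²+c²]) λ
    { zero → trans (+-congˡ (+-congʳ (*-cong (cn₀ m) (cn₀ m))))
               (solve 0 ((con 0 :* con 0 :+ con 0) :+ (con 1 :* con 1 :+ con 0) := con 1) refl)
    ; (suc k) → refl }

  d²+ms²≋1 : (dn m ⊛ dn m) ⊕ (const m ⊛ (sn m ⊛ sn m)) ≋ const 1#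
  d²+ms²≋1 = S.trans (∂≋0⇒const _ δ[d²+ms²]) λ
    { zero → trans (+-congʳ (+-congʳ (*-cong (dn₀ m) (dn₀ m))))
               (solve 1 (λ m → (con 1 :* con 1 :+ con 0) :+ (m :* (con 0 :* con 0 :+ con 0) :+ con 0) := con 1) refl m)
    ; (suc k) → refl }

  r : Series
  r = recip (cn m)

  -- The hidden `g` unfolds to `gₘ m`, so the identities apply to the latter as they stand.
  open WithReciprocal (const e) r m+e≋1 (recip-inverse (cn m) (cn₀ m)) s²+c²≋1 d²+ms²≋1 hiding (g)

  open Polynomials R seriesRing const const-isHomomorphism y (gₘ m)

  ∂²-poly : ∀ {n x f} → Poly n x f →
    Poly (suc n) (e * ((1# + (n × 1# + n × 1#)) * (1# + n × 1#)) * x) (∂ (∂ f))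
  ∂²-poly P = proj₂ (derivatives ∂ ∂-isDerivation ∂-const e w δg δy δw+w² [1+2y]δw [1+2y]w² P)

  -- Even derivatives and the lower triangular factor

  evenDerivative : ℕ → Series
  evenDerivative zero    = gₘ m
  evenDerivative (suc i) = ∂ (∂ (evenDerivative i))

  egfCoeff-evenDerivative : ∀ i j → egfCoeff (evenDerivative i) j ≈ egfCoeff (gₘ m) (2 ℕ.* i ℕ.+ j)
  egfCoeff-evenDerivative zero    j = refl
  egfCoeff-evenDerivative (suc i) j = begin
    egfCoeff (∂ (∂ (evenDerivative i))) j
      ≈⟨ trans (egfCoeff-∂ (∂ (evenDerivative i)) j) (egfCoeff-∂ (evenDerivative i) (suc j)) ⟩
    egfCoeff (evenDerivative i) (2 ℕ.+ j)
      ≈⟨ egfCoeff-evenDerivative i (2 ℕ.+ j) ⟩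
    egfCoeff (gₘ m) (2 ℕ.* i ℕ.+ (2 ℕ.+ j))
      ≡⟨ cong (egfCoeff (gₘ m)) index ⟩
    egfCoeff (gₘ m) (2 ℕ.* suc i ℕ.+ j) ∎
    where
    index : 2 ℕ.* i ℕ.+ (2 ℕ.+ j) ≡ 2 ℕ.* suc i ℕ.+ j
    index = ≡.trans (≡.sym (ℕ.+-assoc (2 ℕ.* i) 2 j))
      (cong (ℕ._+ j) (≡.trans (ℕ.+-comm (2 ℕ.* i) 2) (≡.sym (ℕ.*-suc 2 i))))

  -- The growth factor e (2i + 1)(i + 1) equals (e/2)(2i + 1)(2i + 2), so the top coefficients
  -- telescope to a factorial. This is the origin of the 2 in (1 - m)/2.
  [2+2i]! : ∀ i → ((2 ℕ.* suc i) !) × 1#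
    ≈ (1# + 1#) * ((1# + (i × 1# + i × 1#)) * (1# + i × 1#)) * (((2 ℕ.* i) !) × 1#)
  [2+2i]! i = begin
    ((2 ℕ.* suc i) !) × 1#
      ≡⟨ cong (λ k → (k !) × 1#) (ℕ.*-suc 2 i) ⟩
    ((2 ℕ.+ 2 ℕ.* i) ℕ.* ((1 ℕ.+ 2 ℕ.* i) ℕ.* (2 ℕ.* i) !)) × 1#
      ≈⟨ trans (×1-homo-* (2 ℕ.+ 2 ℕ.* i) ((1 ℕ.+ 2 ℕ.* i) ℕ.* (2 ℕ.* i) !)) (*-congˡ (×1-homo-* (1 ℕ.+ 2 ℕ.* i) ((2 ℕ.* i) !))) ⟩
    (1# + (1# + (2 ℕ.* i) × 1#)) * ((1# + (2 ℕ.* i) × 1#) * F)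
      ≈⟨ *-cong (+-congˡ (+-congˡ 2i)) (*-congʳ (+-congˡ 2i)) ⟩
    (1# + (1# + (1# + (1# + 0#)) * ν)) * ((1# + (1# + (1# + 0#)) * ν) * F)
      ≈⟨ solve 2 (λ ν F → (con 1 :+ (con 1 :+ (con 1 :+ (con 1 :+ con 0)) :* ν)) :* ((con 1 :+ (con 1 :+ (con 1 :+ con 0)) :* ν) :* F)
           := (con 1 :+ con 1) :* ((con 1 :+ (ν :+ ν)) :* (con 1 :+ ν)) :* F) refl ν F ⟩
    (1# + 1#) * ((1# + (ν + ν)) * (1# + ν)) * F ∎
    where
    ν = i × 1#
    F = ((2 ℕ.* i) !) × 1#
    2i : (2 ℕ.* i) × 1# ≈ (1# + (1# + 0#)) * ν
    2i = ×1-homo-* 2 i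

  rows : ∀ i → Poly i (t ^ i * (((2 ℕ.* i) !) × 1#)) (evenDerivative i)
  rows zero    = base (λ k → sym (trans (⊛-cong {g = gₘ m} one (λ _ → refl) k) (⊛-identityˡ (gₘ m) k)))
    where
    one : const (1# * (1# + 0#)) ≋ const 1#
    one zero    = trans (*-identityˡ _) (+-identityʳ 1#)
    one (suc k) = refl
  rows (suc i) = top-cong top (∂²-poly (rows i))
    where
    ν = i × 1#
    F = ((2 ℕ.* i) !) × 1#
    top : e * ((1# + (ν + ν)) * (1# + ν)) * (t ^ i * F) ≈ t ^ suc i * (((2 ℕ.* suc i) !) × 1#)
    top = begin
      e * ((1# + (ν + ν)) * (1# + ν)) * (t ^ i * F)
        ≈⟨ *-identityˡ _ ⟨
      1# * (e * ((1# + (ν + ν)) * (1# + ν)) * (t ^ i * F))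
        -- Writing 1 as 2 times `½` gives the factorial its missing 2 and turns `e` into `t`.
        ≈⟨ *-congʳ (proj₂ (isℚ 1)) ⟨
      ((1# + (1# + 0#)) * ½) * (e * ((1# + (ν + ν)) * (1# + ν)) * (t ^ i * F))
        ≈⟨ solve 5 (λ e h ν p F → ((con 1 :+ (con 1 :+ con 0)) :* h) :* (e :* ((con 1 :+ (ν :+ ν)) :* (con 1 :+ ν)) :* (p :* F))
             := e :* h :* p :* ((con 1 :+ con 1) :* ((con 1 :+ (ν :+ ν)) :* (con 1 :+ ν)) :* F)) refl e ½ ν (t ^ i) F ⟩
      t * t ^ i * ((1# + 1#) * ((1# + (ν + ν)) * (1# + ν)) * F)
        ≈⟨ *-congˡ ([2+2i]! i) ⟨
      t ^ suc i * (((2 ℕ.* suc i) !) × 1#) ∎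

  -- Powers of y and the upper triangular factor

  y₀≈0 : y 0 ≈ 0#
  y₀≈0 = trans (+-identityʳ _) (zeroˡ _)

  y₁≈1 : y 1 ≈ 1#
  y₁≈1 = begin
    0# * z 1 + (sn m 1 * z 0 + 0#)     ≈⟨ +-cong (zeroˡ _) (+-congʳ (*-cong s₁≈1 z₀≈1)) ⟩
    0# + (1# * 1# + 0#)                ≈⟨ solve 0 (con 0 :+ (con 1 :* con 1 :+ con 0) := con 1) refl ⟩
    1#                                 ∎
    where
    s₁≈1 : sn m 1 ≈ 1#
    s₁≈1 = begin
      sn m 1                     ≈⟨ +-identityʳ _ ⟨
      ∂ (sn m) 0                 ≈⟨ sn′ m 0 ⟩
      cn m 0 * dn m 0 + 0#       ≈⟨ trans (+-identityʳ _) (trans (*-cong (cn₀ m) (dn₀ m)) (*-identityˡ 1#)) ⟩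
      1#                         ∎
    z₀≈1 : z 0 ≈ 1#
    -- `sn m 0` and the constant term of `recip (cn m)` compute to `0#` and `1#`, which leaves
    -- arithmetic of constants.
    z₀≈1 = solve 0 ((con 1 :+ con 0) :* (con 1 :* con 1 :+ con 0) :+ con 0 := con 1) refl

  g₀≈1 : gₘ m 0 ≈ 1#
  g₀≈1 = solve 0 ((con 1 :+ con 0) :* con 1 :+ con 0 := con 1) refl

  basis : ℕ → Series
  basis k = (y ^ˢ k) ⊛ gₘ m

  basis-suc : ∀ k → basis (suc k) ≋ y ⊛ basis k
  basis-suc k = ⊛-assoc y (y ^ˢ k) (gₘ m)

  -- Without constant term, `y` is x times `tail y`, so each factor `y` raises the order by one and
  -- multiplies the leading coefficient by `y 1`.
  y⊛-suc : ∀ f k → (y ⊛ f) (suc k) ≈ (tail y ⊛ f) k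
  y⊛-suc f k = trans (+-congʳ (trans (*-congʳ y₀≈0) (zeroˡ _))) (+-identityˡ _)

  basis-order : ∀ k {j} → j ℕ.< k → basis k j ≈ 0#
  basis-order (suc k) {zero}  (s≤s j<k) =
    trans (basis-suc k 0) (trans (+-identityʳ _) (trans (*-congʳ y₀≈0) (zeroˡ _)))
  basis-order (suc k) {suc j} (s≤s j<k) =
    trans (basis-suc k (suc j)) (trans (y⊛-suc (basis k) j) (⊛-order (tail y) k (basis-order k) j<k))

  basis-leading : ∀ k → basis k k ≈ 1#
  basis-leading zero    = trans (⊛-identityˡ (gₘ m) 0) g₀≈1
  basis-leading (suc k) = begin
    basis (suc k) (suc k)     ≈⟨ trans (basis-suc k (suc k)) (y⊛-suc (basis k) k) ⟩
    (tail y ⊛ basis k) k      ≈⟨ ⊛-leading (tail y) k (basis-order k) ⟩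
    y 1 * basis k k           ≈⟨ *-cong y₁≈1 (basis-leading k) ⟩
    1# * 1#                   ≈⟨ *-identityˡ 1# ⟩
    1#                        ∎

  -- Factorisation of the Hankel matrix and its determinant

  sum-apply : ∀ {n} (F : Fin n → Series) j → SSum.sum F j ≈ sum (λ k → F k j)
  sum-apply {zero}  F j = refl
  sum-apply {suc n} F j = +-congˡ (sum-apply (λ k → F (suc k)) j)

  -- Indexed by ℕ, since the factors for every size are truncations of one infinite pair.
  lower upper : ℕ → ℕ → Carrier
  lower i k = coeff (rows i) k
  upper k j = egfCoeff (basis k) j

  Ḧ-entry : ∀ {n} (i j : Fin n) →
    egfCoeff (gₘ m) (2 ℕ.* toℕ i ℕ.+ toℕ j) ≈ ∑[ k < n ] (lower (toℕ i) (toℕ k) * upper (toℕ k) (toℕ j))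
  Ḧ-entry {n} i j = begin
    egfCoeff (gₘ m) (2 ℕ.* toℕ i ℕ.+ toℕ j)
      ≈⟨ egfCoeff-evenDerivative (toℕ i) (toℕ j) ⟨
    J! × evenDerivative (toℕ i) (toℕ j)
      -- The polynomial of row `i` has degree at most `toℕ i`, which is below `n`, so truncating the
      -- sum at `n` loses nothing.
      ≈⟨ ×-congʳ J! (trans (expansion (rows (toℕ i)) (toℕ<n i) (toℕ j)) (sum-apply {n} (λ k → const (l k) ⊛ basis (toℕ k)) (toℕ j))) ⟩
    J! × (∑[ k < n ] (const (l k) ⊛ basis (toℕ k)) (toℕ j))
      ≈⟨ ×-distrib-sum J! {n} (λ k → (const (l k) ⊛ basis (toℕ k)) (toℕ j)) ⟩
    ∑[ k < n ] (J! × (const (l k) ⊛ basis (toℕ k)) (toℕ j))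
      ≈⟨ sum-cong-≋ {n} (λ k → trans (×-congʳ J! (const-⊛ (l k) (basis (toℕ k)) (toℕ j))) (sym (×-comm-* J! _ _))) ⟩
    ∑[ k < n ] (l k * upper (toℕ k) (toℕ j)) ∎
    where
    J! = toℕ j !
    l : Fin n → Carrier
    l k = lower (toℕ i) (toℕ k)

  upper-zero : ∀ {k j} → j ℕ.< k → upper k j ≈ 0#
  upper-zero {k} {j} j<k = trans (×-congʳ (j !) (basis-order k j<k)) (×-zero (j !))
    where
    ×-zero : ∀ n → n × 0# ≈ 0#
    ×-zero n = trans (sym (sum-replicate n)) (sum-replicate-zero n)

  Ḧ-product : ∀ n → Ḧ n (gₘ m) ≈ product {n} (λ i → t ^ toℕ i * ((toℕ i ! ℕ.* (2 ℕ.* toℕ i) !) × 1#))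
  Ḧ-product n = begin
    Ḧ n (gₘ m)
      ≈⟨ det-cong {n} Ḧ-entry ⟩
    det {n} (λ i j → ∑[ k < n ] (lower (toℕ i) (toℕ k) * upper (toℕ k) (toℕ j)))
      ≈⟨ det-LU {n} (λ i k → lower (toℕ i) (toℕ k)) (λ k j → upper (toℕ k) (toℕ j))
           (λ {i} i<k → reflexive (coeff-beyond (rows (toℕ i)) i<k)) upper-zero ⟩
    product {n} (λ i → lower (toℕ i) (toℕ i) * upper (toℕ i) (toℕ i))
      ≈⟨ product-cong {n} diagonal ⟩
    product {n} (λ i → t ^ toℕ i * ((toℕ i ! ℕ.* (2 ℕ.* toℕ i) !) × 1#)) ∎
    where
    open Matrices R using (det)
    diagonal : ∀ (i : Fin n) → lower (toℕ i) (toℕ i) * upper (toℕ i) (toℕ i)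
             ≈ t ^ toℕ i * ((toℕ i ! ℕ.* (2 ℕ.* toℕ i) !) × 1#)
    diagonal i = begin
      lower k k * upper k k
        ≈⟨ *-cong (reflexive (coeff-top (rows k))) (×-congʳ (k !) (basis-leading k)) ⟩
      t ^ k * (((2 ℕ.* k) !) × 1#) * ((k !) × 1#)
        ≈⟨ trans (*-assoc _ _ _) (*-congˡ (*-comm _ _)) ⟩
      t ^ k * (((k !) × 1#) * (((2 ℕ.* k) !) × 1#))
        ≈⟨ *-congˡ (×1-homo-* (k !) ((2 ℕ.* k) !)) ⟨
      t ^ k * ((k ! ℕ.* (2 ℕ.* k) !) × 1#) ∎
      where k = toℕ i

  -- Shifting the index takes one `x` out of each of the `n` remaining factors, so the exponents
  -- obey Pascal's rule.
  product-powers : ∀ x n → product {n} (λ i → x ^ toℕ i) ≈ x ^ (n C 2)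
  product-powers x zero    = refl
  product-powers x (suc n) = begin
    1# * product {n} (λ i → x * x ^ toℕ i)
      ≈⟨ trans (*-identityˡ _) (product-* {n} (λ _ → x) (λ i → x ^ toℕ i)) ⟩
    product {n} (λ _ → x) * product {n} (λ i → x ^ toℕ i)
      ≈⟨ *-cong (product-replicate n) (product-powers x n) ⟩
    x ^ n * x ^ (n C 2)
      ≈⟨ ^-homo-* x n (n C 2) ⟨
    x ^ (n ℕ.+ n C 2)
      ≡⟨ cong (λ k → x ^ (k ℕ.+ n C 2)) (nC1≡n n) ⟨
    x ^ (n C 1 ℕ.+ n C 2)
      ≡⟨ cong (x ^_) (nCk+nC[k+1]≡[n+1]C[k+1] n 1) ⟩
    x ^ (suc n C 2) ∎

  Ḧ-value : ∀ n → n ≥ 1 → Ḧ n (gₘ m)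
    ≈ t ^ (n C 2) * product {n ∸ 1} (λ i → let k = suc (toℕ i) in (k ! ℕ.* (2 ℕ.* k) !) × 1#)
  Ḧ-value (suc n) _ = begin
    Ḧ (suc n) (gₘ m)
      ≈⟨ Ḧ-product (suc n) ⟩
    product {suc n} (λ i → t ^ toℕ i * factor (toℕ i))
      ≈⟨ product-* {suc n} (λ i → t ^ toℕ i) (λ i → factor (toℕ i)) ⟩
    -- The factor at index 0 is `(0 ! ℕ.* 0 !) × 1#`, which computes to `1# + 0#`; removing it lets
    -- the product start at k = 1.
    product {suc n} (λ i → t ^ toℕ i) * ((1# + 0#) * product {n} (λ i → factor (suc (toℕ i))))
      ≈⟨ *-cong (product-powers t (suc n)) (trans (*-congʳ (+-identityʳ 1#)) (*-identityˡ _)) ⟩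
    t ^ (suc n C 2) * product {n} (λ i → factor (suc (toℕ i))) ∎
    where
    factor : ℕ → Carrier
    factor k = (k ! ℕ.* (2 ℕ.* k) !) × 1#

theorem19p1 :
    ∀ {c ℓ} (R : CommutativeRing c ℓ) (isℚ : IsℚAlgebra R) →
    let open CommutativeRing R
        open RawSemiringDefs (Semiring.rawSemiring semiring)
        open FormalSeries R isℚ
    in ∀ (m : Carrier) (n : ℕ) → n ≥ 1 →
       Ḧ n (g m)
         ≈ ((1# - m) * ½) ^ (n C 2)
           * product {n ∸ 1} (λ i → let k = suc (toℕ i) in (k ! ℕ.* (2 ℕ.* k) !) × 1#)
theorem19p1 = HankelEvaluation.Ḧ-value
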